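{- For all $k\ge 1$, $$I_{213\dots k}(x)=\frac{1}{x\,U_k\left(\frac{1}{2x}\right)}\sum_{j=0}^{k-1}U_j\left(\frac{1}{2x}\right),$$ where $213\dots k$ is the permutation $(2,1,3,4,\dots,k)\in S_k$ (the pattern $21$ for $k=2$, and the pattern $1$ for $k=1$), $I_{213\dots k}(x)=\sum_{n\ge 0}I_{213\dots k}(n)x^n$, and $I_{213\dots k}(n)$ is the number of involutions in $S_n$ avoiding both $132$ and $213\dots k$.
   Context: $S_n$ is the set of permutations of $\{1,\dots,n\}$. A permutation $\alpha\in S_n$ contains a pattern $\tau\in S_k$ if there are $1\le i_1<\dots<i_k\le n$ such that $(\alpha_{i_1},\dots,\alpha_{i_k})$ is order-isomorphic to $\tau$; otherwise $\alpha$ avoids $\tau$. An involution is a permutation equal to its own inverse; the empty permutation is counted for $n=0$. $U_r$ denotes the Chebyshev polynomial of the second kind, $U_r(\cos\theta)=\sin((r+1)\theta)/\sin\theta$. The identity is one of rational functions, expanded as power series in $x$. -}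

module Defs where

open import Algebra.Bundles using (CommutativeRing)
open import Algebra.Bundles.Raw using (RawRing)
import Algebra.Definitions.RawMonoid as RawMonoidDefs
open import Data.Fin.Base as Fin using (Fin; zero; suc; toℕ; punchIn)
open import Data.Fin.Patterns using (0F; 1F; 2F)
import Data.Fin.Properties as Finₚ
open import Data.Fin.Permutation
  using (Permutation′; _⟨$⟩ʳ_; _≈_; id; flip; transpose; insert; remove;
         insert-remove)
import Data.Integer.Base as ℤ
open import Data.List.Base using (List; [_]; length; filter; allFin; map; concatMap)
open import Data.List.Relation.Unary.All as All using ([]; _∷_)
import Data.List.Relation.Unary.All.Properties as Allₚ
open import Data.List.Relation.Unary.Any as Any using (Any; here)
import Data.List.Relation.Unary.Any.Properties as Anyₚ
open import Data.List.Relation.Unary.AllPairs as AllPairs using (AllPairs; []; _∷_)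
import Data.List.Relation.Unary.AllPairs.Properties as AllPairsₚ
import Data.List.Membership.Propositional.Properties as ∈ₚ
import Data.List.Relation.Unary.Unique.Propositional.Properties as Uniqueₚ
open import Data.Nat.Base using (ℕ; zero; suc; _∸_; 2+) renaming (_+_ to _+ℕ_)
open import Data.Product.Base using (_×_; _,_; ∃; uncurry)
open import Data.Rational.Base as ℚ using (ℚ; 0ℚ; 1ℚ; ½; _/_)
open import Data.Vec.Base using (Vec; []; _∷_; lookup)
open import Function.Bundles using (_⇔_; mk⇔; Equivalence)
open import Level using (0ℓ)
open import Relation.Binary.PropositionalEquality using (_≡_; refl; sym; trans; cong)
open import Relation.Nullary using (¬_; Dec)
open import Relation.Nullary.Decidable using (map′; ¬?; _×-dec_; _→-dec_)
open import Relation.Unary using (Decidable)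

------------------------------------------------------------------------
-- Pattern avoidance
--
-- Positions and values are numbered from 0: an element of Sₙ is a
-- bijection of Fin n with itself, and its i-th entry is π ⟨$⟩ʳ i.

StrictlyIncreasing : ∀ {n k} → Vec (Fin n) k → Set
StrictlyIncreasing is = ∀ a b → a Fin.< b → lookup is a Fin.< lookup is b

OrderIsomorphicAt : ∀ {n k} → Permutation′ n → Permutation′ k → Vec (Fin n) k → Set
OrderIsomorphicAt α τ is =
  ∀ a b → (α ⟨$⟩ʳ lookup is a) Fin.< (α ⟨$⟩ʳ lookup is b) ⇔ (τ ⟨$⟩ʳ a) Fin.< (τ ⟨$⟩ʳ b)

_Contains_ : ∀ {n k} → Permutation′ n → Permutation′ k → Set
_Contains_ {n} {k} α τ = ∃ λ (is : Vec (Fin n) k) → StrictlyIncreasing is × OrderIsomorphicAt α τ is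

_Avoids_ : ∀ {n k} → Permutation′ n → Permutation′ k → Set
α Avoids τ = ¬ (α Contains τ)

Involution : ∀ {n} → Permutation′ n → Set
Involution α = α ≈ flip α

pattern132 : Permutation′ 3
pattern132 = transpose 1F 2F

-- 213…k. The value at k = 0 is irrelevant.
pattern213⋯ : ∀ k → Permutation′ k
pattern213⋯ 0      = id
pattern213⋯ 1      = id
pattern213⋯ (2+ _) = transpose 0F 1F

AvoidingInvolution : ∀ k {n} → Permutation′ n → Set
AvoidingInvolution k α = Involution α × α Avoids pattern132 × α Avoids pattern213⋯ k

------------------------------------------------------------------------
-- Decidability

∃Vec? : ∀ {n} k {P : Vec (Fin n) k → Set} → Decidable P → Dec (∃ P)
∃Vec? zero    P? = map′ (λ p → [] , p) (λ { ([] , p) → p }) (P? [])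
∃Vec? (suc k) P? =
  map′ (λ { (i , is , p) → i ∷ is , p }) (λ { (i ∷ is , p) → i , is , p })
       (Finₚ.any? λ i → ∃Vec? k λ is → P? (i ∷ is))

_⇔?_ : ∀ {A B : Set} → Dec A → Dec B → Dec (A ⇔ B)
A? ⇔? B? = map′ (uncurry mk⇔) (λ e → Equivalence.to e , Equivalence.from e)
                ((A? →-dec B?) ×-dec (B? →-dec A?))

contains? : ∀ {n k} (α : Permutation′ n) (τ : Permutation′ k) → Dec (α Contains τ)
contains? α τ = ∃Vec? _ λ is →
  (Finₚ.all? λ a → Finₚ.all? λ b → (a Finₚ.<? b) →-dec (lookup is a Finₚ.<? lookup is b))
  ×-dec
  (Finₚ.all? λ a → Finₚ.all? λ b →
    ((α ⟨$⟩ʳ lookup is a) Finₚ.<? (α ⟨$⟩ʳ lookup is b)) ⇔? ((τ ⟨$⟩ʳ a) Finₚ.<? (τ ⟨$⟩ʳ b)))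

avoidingInvolution? : ∀ k {n} (α : Permutation′ n) → Dec (AvoidingInvolution k α)
avoidingInvolution? k α =
  (Finₚ.all? λ i → (α ⟨$⟩ʳ i) Finₚ.≟ (flip α ⟨$⟩ʳ i))
  ×-dec ¬? (contains? α pattern132)
  ×-dec ¬? (contains? α (pattern213⋯ k))

------------------------------------------------------------------------
-- Counting

-- Every element of Sₙ exactly once up to pointwise equality, as shown
-- by permutations-complete and permutations-distinct.
permutations : ∀ n → List (Permutation′ n)
permutations zero    = [ id ]
permutations (suc n) = concatMap (λ j → map (insert 0F j) (permutations n)) (allFin (suc n))

I : ℕ → ℕ → ℕ
I k n = length (filter (avoidingInvolution? k) (permutations n))

private
  insert-cong : ∀ {n} (j : Fin (suc n)) {π ρ : Permutation′ n} → π ≈ ρ → insert 0F j π ≈ insert 0F j ρ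
  insert-cong j π≈ρ zero    = refl
  insert-cong j π≈ρ (suc i) = cong (punchIn j) (π≈ρ i)

  insert-injective : ∀ {n} (j : Fin (suc n)) {π ρ : Permutation′ n} → insert 0F j π ≈ insert 0F j ρ → π ≈ ρ
  insert-injective j eq i = Finₚ.punchIn-injective j _ _ (eq (suc i))

permutations-complete : ∀ {n} (π : Permutation′ n) → Any (π ≈_) (permutations n)
permutations-complete {zero}  π = here λ ()
permutations-complete {suc n} π =
  Anyₚ.concatMap⁺ _ (Any.map found (∈ₚ.∈-allFin (π ⟨$⟩ʳ 0F)))
  where
  found : ∀ {j} → π ⟨$⟩ʳ 0F ≡ j → Any (π ≈_) (map (insert 0F j) (permutations n))
  found refl = Anyₚ.map⁺ (Any.map
    (λ {ρ} eq i → trans (sym (insert-remove 0F π i)) (insert-cong _ {remove 0F π} {ρ} eq i))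
    (permutations-complete (remove 0F π)))

permutations-distinct : ∀ n → AllPairs (λ π ρ → ¬ (π ≈ ρ)) (permutations n)
permutations-distinct zero    = [] ∷ []
permutations-distinct (suc n) = AllPairsₚ.concat⁺
  (Allₚ.map⁺ (All.universal (λ j → AllPairsₚ.map⁺
     (AllPairs.map (λ {π} {ρ} π≉ρ eq → π≉ρ (insert-injective j {π} {ρ} eq)) (permutations-distinct n))) _))
  (AllPairsₚ.map⁺ (AllPairs.map
     (λ j≢l → Allₚ.map⁺ (All.universal (λ _ → Allₚ.map⁺ (All.universal (λ _ eq → j≢l (eq 0F)) _)) _))
     (Uniqueₚ.allFin⁺ (suc n))))

------------------------------------------------------------------------
-- Chebyshev polynomials of the second kind

module Chebyshev {c ℓ} (R : RawRing c ℓ) where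
  open RawRing R

  U : ℕ → Carrier → Carrier
  U 0      t = 1#
  U 1      t = (1# + 1#) * t
  U (2+ r) t = (1# + 1#) * t * U (suc r) t + - U r t

-- U_r(cos θ) sin θ = sin ((r + 1) θ): here c and s are cos θ and sin θ,
-- and the multiple angles are given by the addition formulas.
module MultipleAngle {a ℓ} (R : CommutativeRing a ℓ) where
  open CommutativeRing R
    renaming (_≈_ to _≃_; refl to ≃-refl; sym to ≃-sym; trans to ≃-trans)
  open Chebyshev rawRing

  module _ (c s : Carrier) where
    sin cos : ℕ → Carrier
    sin zero    = 0#
    sin (suc n) = sin n * c + cos n * s
    cos zero    = 1#
    cos (suc n) = cos n * c - sin n * s

    module _ (c²+s²≃1 : c * c + s * s ≃ 1#) where
      open import Algebra.Solver.Ring.NaturalCoefficients.Default commutativeSemiring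
        using (solve; _:=_; _:+_; _:*_; con)
      open import Algebra.Properties.Ring ring using (-‿distribˡ-*)
      open import Relation.Binary.Reasoning.Setoid setoid

      private
        cancel : ∀ x y → x - y + y ≃ x
        cancel x y = ≃-trans (+-assoc x (- y) y) (≃-trans (+-congˡ (-‿inverseˡ y)) (+-identityʳ x))

        cancel′ : ∀ x y → x + y - y ≃ x
        cancel′ x y = ≃-trans (+-assoc x y (- y)) (≃-trans (+-congˡ (-‿inverseʳ y)) (+-identityʳ x))

        sin-recurrence : ∀ n → sin (2+ n) + sin n ≃ (1# + 1#) * c * sin (suc n)
        sin-recurrence n = begin
          sin (suc n) * c + cos (suc n) * s + sin n
            ≈⟨ +-congˡ (≃-trans (≃-sym (*-identityʳ _)) (*-congˡ (≃-sym c²+s²≃1))) ⟩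
          sin (suc n) * c + cos (suc n) * s + sin n * (c * c + s * s)
            ≈⟨ solve 5 (λ S₁ C₁ S c s →
                 S₁ :* c :+ C₁ :* s :+ S :* (c :* c :+ s :* s) :=
                 S₁ :* c :+ (S :* c :* c :+ (C₁ :+ S :* s) :* s)) ≃-refl
               (sin (suc n)) (cos (suc n)) (sin n) c s ⟩
          sin (suc n) * c + (sin n * c * c + (cos (suc n) + sin n * s) * s)
            ≈⟨ +-congˡ (+-congˡ (*-congʳ (cancel _ _))) ⟩
          sin (suc n) * c + (sin n * c * c + cos n * c * s)
            ≈⟨ solve 4 (λ S C c s →
                 (S :* c :+ C :* s) :* c :+ (S :* c :* c :+ C :* c :* s) :=
                 (con 1 :+ con 1) :* c :* (S :* c :+ C :* s)) ≃-refl
               (sin n) (cos n) c s ⟩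
          (1# + 1#) * c * sin (suc n) ∎

      U-multipleAngle : ∀ r → U r c * s ≃ sin (suc r)
      U-multipleAngle 0 = ≃-sym (≃-trans (+-congʳ (zeroˡ c)) (+-identityˡ _))
      U-multipleAngle 1 = begin
        (1# + 1#) * c * s                     ≈⟨ *-assoc _ _ _ ⟩
        (1# + 1#) * (c * s)                   ≈⟨ *-congˡ (*-comm c s) ⟩
        (1# + 1#) * (s * c)                   ≈⟨ *-assoc _ _ _ ⟨
        (1# + 1#) * s * c                     ≈⟨ solve 2 (λ s c →
          (con 1 :+ con 1) :* s :* c := (con 1 :+ con 1) :* c :* (con 0 :* c :+ con 1 :* s)) ≃-refl s c ⟩
        (1# + 1#) * c * sin 1                 ≈⟨ sin-recurrence 0 ⟨
        sin 2 + sin 0                         ≈⟨ +-identityʳ _ ⟩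
        sin 2                                 ∎
      U-multipleAngle (2+ r) = begin
        ((1# + 1#) * c * U (suc r) c - U r c) * s
          ≈⟨ distribʳ s _ _ ⟩
        (1# + 1#) * c * U (suc r) c * s + - U r c * s
          ≈⟨ +-cong (*-assoc _ _ _) (≃-sym (-‿distribˡ-* _ _)) ⟩
        (1# + 1#) * c * (U (suc r) c * s) - U r c * s
          ≈⟨ +-cong (*-congˡ (U-multipleAngle (suc r))) (-‿cong (U-multipleAngle r)) ⟩
        (1# + 1#) * c * sin (2+ r) - sin (suc r)
          ≈⟨ +-congʳ (sin-recurrence (suc r)) ⟨
        sin (2+ (suc r)) + sin (suc r) - sin (suc r)
          ≈⟨ cancel′ _ _ ⟩
        sin (2+ (suc r)) ∎

------------------------------------------------------------------------
-- Formal Laurent series over ℚ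

PowerSeries : Set
PowerSeries = ℕ → ℚ

x^_·_ : ℕ → PowerSeries → PowerSeries
(x^ zero · f)  n       = f n
(x^ suc p · f) zero    = 0ℚ
(x^ suc p · f) (suc n) = (x^ p · f) n

infixl 6 _⊕_
infixl 7 _⊛_

_⊕_ _⊛_ : PowerSeries → PowerSeries → PowerSeries
(f ⊕ g) n = f n ℚ.+ g n
(f ⊛ g) n = sum {suc n} (λ i → f (toℕ i) ℚ.* g (n ∸ toℕ i))
  where open RawMonoidDefs ℚ.+-0-rawMonoid using (sum)

constant : ℚ → PowerSeries
constant q zero    = q
constant q (suc _) = 0ℚ

-- f ÷x^ p is x⁻ᵖ f(x). Since x is not a zero divisor in ℚ[[x]], every
-- element of ℚ((x)) has this form, and equality is cross-multiplication.
infix 8 _÷x^_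
record LaurentSeries : Set where
  constructor _÷x^_
  field
    numerator : PowerSeries
    poleOrder : ℕ

-- The ring ℚ((x)), which contains ℚ(x) through expansion at 0 and in
-- which ℚ[[x]] embeds.
laurent : RawRing 0ℓ 0ℓ
laurent = record
  { Carrier = LaurentSeries
  ; _≈_     = λ { (f ÷x^ p) (g ÷x^ q) → ∀ n → (x^ q · f) n ≡ (x^ p · g) n }
  ; _+_     = λ { (f ÷x^ p) (g ÷x^ q) → ((x^ q · f) ⊕ (x^ p · g)) ÷x^ (p +ℕ q) }
  ; _*_     = λ { (f ÷x^ p) (g ÷x^ q) → (f ⊛ g) ÷x^ (p +ℕ q) }
  ; -_      = λ { (f ÷x^ p) → (λ n → ℚ.- f n) ÷x^ p }
  ; 0#      = constant 0ℚ ÷x^ 0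
  ; 1#      = constant 1ℚ ÷x^ 0
  }

x : LaurentSeries
x = (x^ 1 · constant 1ℚ) ÷x^ 0

-- 1/(2x)
½x⁻¹ : LaurentSeries
½x⁻¹ = constant ½ ÷x^ 1

generatingFunction : (ℕ → ℕ) → LaurentSeries
generatingFunction a = (λ n → ℤ.+ a n / 1) ÷x^ 0

module Submission where

-- An involution with first entry suc j ≠ 0 arises from a shorter one π by adding the 2-cycle (0 suc j).
-- For k = 3 + m the result avoids both patterns iff π does, the first entry of π is at most j, and either
-- at most m positions of the result lie right of suc j or j is the positive first entry of π. In terms
-- of the size and the bound on the first entry this recurrence is the one for nearest-neighbour walks on
-- a path with k vertices, so I k n is the number of n-step walks starting at an end of the path.
-- Counted by last vertex, their generating functions satisfy the Chebyshev recurrence: the series of the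
-- walks from one end to the vertex at distance j from the other end is U_j(1/2x) times r, the series of
-- the walks from end to end.

-- Involutions of size `n` with first entry at most `p` sit at vertex `n - p + 1`, with `p` steps
-- still to go; the full count `p = n` starts at vertex 1. If the first entry equals the bound, its
-- 2-cycle is stripped: the size drops by two and the bound by one, a step towards vertex 1. If it
-- is smaller, only the bound drops, a step away from vertex 1. At vertex 1 the bound cannot be
-- attained, so the first move is missing. At vertex `k` the second one is, and there the two
-- summands have to be collapsed into one. This recursion strips the first step of a walk, so it
-- sorts walks by their starting vertex, whereas the Chebyshev recurrence appears when they are
-- sorted by their last vertex. The symmetry of the adjacency matrix of the path leads from one
-- count to the other.

open import Defs
open import Algebra.Bundles using (CommutativeMonoid)
open import Algebra.Bundles.Raw using (RawRing)
open import Algebra.Definitions.RawMonoid (RawRing.+-rawMonoid laurent) using (sum)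
import Algebra.Properties.CommutativeSemigroup as CommutativeSemigroupProperties
open import Data.Bool.Base using (Bool; true; false; if_then_else_; T)
open import Data.Empty using (⊥)
open import Data.Fin.Base as Fin using (Fin; zero; suc; toℕ; punchIn; punchOut; fromℕ<)
open import Data.Fin.Patterns using (0F; 1F; 2F)
open import Data.Fin.Permutation
  using (Permutation′; _⟨$⟩ʳ_; id; insert; remove; insert-remove; insert-punchIn; inverseʳ; inverseˡ)
  renaming (_≈_ to _≈ₚ_)
import Data.Fin.Properties as Finₚ
import Data.Integer.Base as ℤ
import Data.Integer.Properties as ℤₚ
open import Data.List.Base as List using (List; []; _∷_; _++_; [_]; length; map)
import Data.List.Membership.Propositional.Properties as ∈ₚ
import Data.List.Membership.Setoid.Properties as Membershipₚ
open import Data.List.Properties using (length-map; length-++)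
open import Data.List.Relation.Unary.All as All using (All; []; _∷_)
import Data.List.Relation.Unary.All.Properties as Allₚ
open import Data.List.Relation.Unary.AllPairs as AllPairs using (AllPairs; []; _∷_)
import Data.List.Relation.Unary.AllPairs.Properties as AllPairsₚ
open import Data.List.Relation.Unary.Any as Any using (Any; here)
import Data.List.Relation.Unary.Any.Properties as Anyₚ
open import Data.Nat.Base as ℕ hiding (_*_)
open import Data.Nat.Properties
open import Data.Nat.Solver using (module +-*-Solver)
open import Data.Product.Base using (_×_; _,_; ∃; proj₁; proj₂)
open import Data.Rational.Base as ℚ using (ℚ; 0ℚ; 1ℚ; ½)
import Data.Rational.Properties as ℚₚ
import Data.Rational.Unnormalised.Base as ℚᵘ
import Data.Rational.Unnormalised.Properties as ℚᵘₚ
open import Data.Sum.Base using (_⊎_; inj₁; inj₂)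
open import Data.Vec.Base using (lookup; tabulate)
open import Data.Vec.Properties using (lookup∘tabulate)
open import Function.Base using (_∘_)
open import Function.Bundles using (_⇔_; mk⇔; module Equivalence; module Inverse)
open import Level using (0ℓ)
open import Relation.Binary.Bundles using (Setoid)
open import Relation.Binary.Definitions using (tri<; tri≈; tri>)
open import Relation.Binary.PropositionalEquality hiding ([_])
open import Relation.Nullary using (¬_; Dec; contradiction)
open import Relation.Nullary.Decidable using (yes; no; _×-dec_)
open RawRing laurent using (_≈_; _*_; 1#) renaming (_+_ to _+ᴸ_; -_ to -ᴸ_)
open Chebyshev laurent using (U)
open LaurentSeries

-- Power series

x^-cong : ∀ p {f g} → f ≗ g → x^ p · f ≗ x^ p · g
x^-cong zero    f≗g n       = f≗g n
x^-cong (suc p) f≗g zero    = refl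
x^-cong (suc p) f≗g (suc n) = x^-cong p f≗g n

x^-+ : ∀ p q f → x^ (p + q) · f ≗ x^ p · (x^ q · f)
x^-+ zero    q f n       = refl
x^-+ (suc p) q f zero    = refl
x^-+ (suc p) q f (suc n) = x^-+ p q f n

x^-comm : ∀ p q f → x^ p · (x^ q · f) ≗ x^ q · (x^ p · f)
x^-comm p q f n = begin
  (x^ p · (x^ q · f)) n ≡⟨ x^-+ p q f n ⟨
  (x^ (p + q) · f) n    ≡⟨ cong (λ r → (x^ r · f) n) (+-comm p q) ⟩
  (x^ (q + p) · f) n    ≡⟨ x^-+ q p f n ⟩
  (x^ q · (x^ p · f)) n ∎
  where open ≡-Reasoning

x^-⊕ : ∀ p f g → x^ p · (f ⊕ g) ≗ (x^ p · f) ⊕ (x^ p · g)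
x^-⊕ zero    f g n       = refl
x^-⊕ (suc p) f g zero    = refl
x^-⊕ (suc p) f g (suc n) = x^-⊕ p f g n

⊖_ : PowerSeries → PowerSeries
(⊖ f) n = ℚ.- f n

x^-⊖ : ∀ p f → x^ p · (⊖ f) ≗ ⊖ (x^ p · f)
x^-⊖ zero    f n       = refl
x^-⊖ (suc p) f zero    = refl
x^-⊖ (suc p) f (suc n) = x^-⊖ p f n

-- The coefficient `(f ⊛ g) (suc n)` reduces to `f 0 ℚ.* g (suc n) ℚ.+ ((f ∘ suc) ⊛ g) n`. Most
-- facts about `⊛` are therefore proved by induction on the index of the coefficient, with `f`
-- replaced by its shift.
⊛-cong : ∀ {f g f′ g′} → f ≗ f′ → g ≗ g′ → f ⊛ g ≗ f′ ⊛ g′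
⊛-cong f≗ g≗ zero    = cong₂ ℚ._+_ (cong₂ ℚ._*_ (f≗ 0) (g≗ 0)) refl
⊛-cong f≗ g≗ (suc n) = cong₂ ℚ._+_ (cong₂ ℚ._*_ (f≗ 0) (g≗ (suc n))) (⊛-cong (f≗ ∘ suc) g≗ n)

⊛-zeroˡ : ∀ {f} g → (∀ n → f n ≡ 0ℚ) → ∀ n → (f ⊛ g) n ≡ 0ℚ
⊛-zeroˡ {f} g f≗0 zero    = begin
  f 0 ℚ.* g 0 ℚ.+ 0ℚ ≡⟨ ℚₚ.+-identityʳ _ ⟩
  f 0 ℚ.* g 0        ≡⟨ cong (ℚ._* g 0) (f≗0 0) ⟩
  0ℚ ℚ.* g 0         ≡⟨ ℚₚ.*-zeroˡ (g 0) ⟩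
  0ℚ                 ∎
  where open ≡-Reasoning
⊛-zeroˡ {f} g f≗0 (suc n) = cong₂ ℚ._+_
  (trans (cong (ℚ._* g (suc n)) (f≗0 0)) (ℚₚ.*-zeroˡ (g (suc n))))
  (⊛-zeroˡ g (f≗0 ∘ suc) n)

⊛-identityˡ : ∀ f → constant 1ℚ ⊛ f ≗ f
⊛-identityˡ f zero    = trans (ℚₚ.+-identityʳ _) (ℚₚ.*-identityˡ (f 0))
⊛-identityˡ f (suc n) = begin
  1ℚ ℚ.* f (suc n) ℚ.+ ((constant 1ℚ ∘ suc) ⊛ f) n
    ≡⟨ cong₂ ℚ._+_ (ℚₚ.*-identityˡ (f (suc n))) (⊛-zeroˡ f (λ _ → refl) n) ⟩
  f (suc n) ℚ.+ 0ℚ ≡⟨ ℚₚ.+-identityʳ _ ⟩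
  f (suc n)        ∎
  where open ≡-Reasoning

⊛-identityʳ : ∀ f → f ⊛ constant 1ℚ ≗ f
⊛-identityʳ f zero    = trans (ℚₚ.+-identityʳ _) (ℚₚ.*-identityʳ (f 0))
⊛-identityʳ f (suc n) = begin
  f 0 ℚ.* 0ℚ ℚ.+ ((f ∘ suc) ⊛ constant 1ℚ) n
    ≡⟨ cong₂ ℚ._+_ (ℚₚ.*-zeroʳ (f 0)) (⊛-identityʳ (f ∘ suc) n) ⟩
  0ℚ ℚ.+ f (suc n) ≡⟨ ℚₚ.+-identityˡ _ ⟩
  f (suc n)        ∎
  where open ≡-Reasoning

⊛-⊕ : ∀ f g h → f ⊛ (g ⊕ h) ≗ (f ⊛ g) ⊕ (f ⊛ h)
⊛-⊕ f g h = go f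
  where
  open ≡-Reasoning
  open CommutativeSemigroupProperties
    (CommutativeMonoid.commutativeSemigroup ℚₚ.+-0-commutativeMonoid) using (interchange)
  go : ∀ f n → (f ⊛ (g ⊕ h)) n ≡ (f ⊛ g) n ℚ.+ (f ⊛ h) n
  go f zero    = begin
    f 0 ℚ.* (g 0 ℚ.+ h 0) ℚ.+ (0ℚ ℚ.+ 0ℚ)
      ≡⟨ cong (ℚ._+ (0ℚ ℚ.+ 0ℚ)) (ℚₚ.*-distribˡ-+ (f 0) (g 0) (h 0)) ⟩
    (f 0 ℚ.* g 0 ℚ.+ f 0 ℚ.* h 0) ℚ.+ (0ℚ ℚ.+ 0ℚ)
      ≡⟨ interchange (f 0 ℚ.* g 0) (f 0 ℚ.* h 0) 0ℚ 0ℚ ⟩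
    (f 0 ℚ.* g 0 ℚ.+ 0ℚ) ℚ.+ (f 0 ℚ.* h 0 ℚ.+ 0ℚ) ∎
  go f (suc n) = begin
    f 0 ℚ.* (g (suc n) ℚ.+ h (suc n)) ℚ.+ ((f ∘ suc) ⊛ (g ⊕ h)) n
      ≡⟨ cong₂ ℚ._+_ (ℚₚ.*-distribˡ-+ (f 0) (g (suc n)) (h (suc n))) (go (f ∘ suc) n) ⟩
    (f 0 ℚ.* g (suc n) ℚ.+ f 0 ℚ.* h (suc n)) ℚ.+ (((f ∘ suc) ⊛ g) n ℚ.+ ((f ∘ suc) ⊛ h) n)
      ≡⟨ interchange (f 0 ℚ.* g (suc n)) (f 0 ℚ.* h (suc n)) (((f ∘ suc) ⊛ g) n) (((f ∘ suc) ⊛ h) n) ⟩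
    (f ⊛ g) (suc n) ℚ.+ (f ⊛ h) (suc n) ∎

⊛-⊖ : ∀ f g → f ⊛ (⊖ g) ≗ ⊖ (f ⊛ g)
⊛-⊖ f g zero    = begin
  f 0 ℚ.* ℚ.- g 0 ℚ.+ 0ℚ       ≡⟨ cong (ℚ._+ 0ℚ) (ℚₚ.neg-distribʳ-* (f 0) (g 0)) ⟨
  ℚ.- (f 0 ℚ.* g 0) ℚ.+ ℚ.- 0ℚ ≡⟨ ℚₚ.neg-distrib-+ (f 0 ℚ.* g 0) 0ℚ ⟨
  ℚ.- (f 0 ℚ.* g 0 ℚ.+ 0ℚ)     ∎
  where open ≡-Reasoning
⊛-⊖ f g (suc n) = begin
  f 0 ℚ.* ℚ.- g (suc n) ℚ.+ ((f ∘ suc) ⊛ (⊖ g)) n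
    ≡⟨ cong₂ ℚ._+_ (ℚₚ.neg-distribʳ-* (f 0) (g (suc n))) (sym (⊛-⊖ (f ∘ suc) g n)) ⟨
  ℚ.- (f 0 ℚ.* g (suc n)) ℚ.+ ℚ.- ((f ∘ suc) ⊛ g) n
    ≡⟨ ℚₚ.neg-distrib-+ (f 0 ℚ.* g (suc n)) (((f ∘ suc) ⊛ g) n) ⟨
  ℚ.- (f ⊛ g) (suc n) ∎
  where open ≡-Reasoning

⊛-x· : ∀ f g → f ⊛ (x^ 1 · g) ≗ x^ 1 · (f ⊛ g)
⊛-x· f g zero          = trans (ℚₚ.+-identityʳ _) (ℚₚ.*-zeroʳ (f 0))
⊛-x· f g (suc zero)    = cong (f 0 ℚ.* g 0 ℚ.+_) (⊛-x· (f ∘ suc) g 0)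
⊛-x· f g (suc (suc n)) = cong (f 0 ℚ.* g (suc n) ℚ.+_) (⊛-x· (f ∘ suc) g (suc n))

⊛-x^ : ∀ p f g → f ⊛ (x^ p · g) ≗ x^ p · (f ⊛ g)
⊛-x^ zero    f g n = refl
⊛-x^ (suc p) f g n = begin
  (f ⊛ (x^ suc p · g)) n       ≡⟨ ⊛-cong {f} (λ _ → refl) (x^-+ 1 p g) n ⟩
  (f ⊛ (x^ 1 · (x^ p · g))) n  ≡⟨ ⊛-x· f (x^ p · g) n ⟩
  (x^ 1 · (f ⊛ (x^ p · g))) n  ≡⟨ x^-cong 1 (⊛-x^ p f g) n ⟩
  (x^ 1 · (x^ p · (f ⊛ g))) n  ≡⟨ x^-+ 1 p (f ⊛ g) n ⟨
  (x^ suc p · (f ⊛ g)) n       ∎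
  where open ≡-Reasoning

x·⊛ : ∀ f → (x^ 1 · constant 1ℚ) ⊛ f ≗ x^ 1 · f
x·⊛ f zero    = trans (ℚₚ.+-identityʳ _) (ℚₚ.*-zeroˡ (f 0))
x·⊛ f (suc n) = begin
  0ℚ ℚ.* f (suc n) ℚ.+ (constant 1ℚ ⊛ f) n
    ≡⟨ cong₂ ℚ._+_ (ℚₚ.*-zeroˡ (f (suc n))) (⊛-identityˡ f n) ⟩
  0ℚ ℚ.+ f n                               ≡⟨ ℚₚ.+-identityˡ _ ⟩
  f n                                      ∎
  where open ≡-Reasoning

-- The factor `2t` of the Chebyshev recurrence at `t = 1/(2x)`, written so that it matches the
-- unfolding of `U`.
1/x : LaurentSeries
1/x = (1# +ᴸ 1#) * ½x⁻¹

numerator-1/x : numerator 1/x ≗ constant 1ℚ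
numerator-1/x zero    = refl
numerator-1/x (suc n) = cong (0ℚ ℚ.+_) (⊛-zeroˡ (constant ½) (λ _ → refl) n)

-- g · u = w in ℚ((x)), for power series g and w.
_·_≐_ : PowerSeries → LaurentSeries → PowerSeries → Set
g · u ≐ w = g ⊛ numerator u ≗ x^ poleOrder u · w

module Multiples (g : PowerSeries) where

  ≐-resp-≗ : ∀ u {w w′} → w ≗ w′ → g · u ≐ w → g · u ≐ w′
  ≐-resp-≗ u w≗w′ gu≐w n = trans (gu≐w n) (x^-cong (poleOrder u) w≗w′ n)

  ≐-1 : g · 1# ≐ g
  ≐-1 = ⊛-identityʳ g

  ≐-+ : ∀ u v {w z} → g · u ≐ w → g · v ≐ z → g · (u +ᴸ v) ≐ (w ⊕ z)
  ≐-+ (f ÷x^ p) (h ÷x^ q) {w} {z} gu gv n = begin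
    (g ⊛ ((x^ q · f) ⊕ (x^ p · h))) n
      ≡⟨ ⊛-⊕ g (x^ q · f) (x^ p · h) n ⟩
    (g ⊛ (x^ q · f)) n ℚ.+ (g ⊛ (x^ p · h)) n
      ≡⟨ cong₂ ℚ._+_ (⊛-x^ q g f n) (⊛-x^ p g h n) ⟩
    (x^ q · (g ⊛ f)) n ℚ.+ (x^ p · (g ⊛ h)) n
      ≡⟨ cong₂ ℚ._+_ (x^-cong q gu n) (x^-cong p gv n) ⟩
    (x^ q · (x^ p · w)) n ℚ.+ (x^ p · (x^ q · z)) n
      ≡⟨ cong (ℚ._+ (x^ p · (x^ q · z)) n) (x^-comm q p w n) ⟩
    (x^ p · (x^ q · w)) n ℚ.+ (x^ p · (x^ q · z)) n
      ≡⟨ cong₂ ℚ._+_ (x^-+ p q w n) (x^-+ p q z n) ⟨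
    (x^ (p + q) · w) n ℚ.+ (x^ (p + q) · z) n
      ≡⟨ x^-⊕ (p + q) w z n ⟨
    (x^ (p + q) · (w ⊕ z)) n ∎
    where open ≡-Reasoning

  ≐-neg : ∀ u {w} → g · u ≐ w → g · (-ᴸ u) ≐ (⊖ w)
  ≐-neg (f ÷x^ p) {w} gu n = begin
    (g ⊛ (⊖ f)) n        ≡⟨ ⊛-⊖ g f n ⟩
    ℚ.- (g ⊛ f) n        ≡⟨ cong ℚ.-_ (gu n) ⟩
    ℚ.- (x^ p · w) n     ≡⟨ x^-⊖ p w n ⟨
    (x^ p · (⊖ w)) n     ∎
    where open ≡-Reasoning

  ≐-1/x : ∀ {w} → g ≗ x^ 1 · w → g · 1/x ≐ w
  ≐-1/x g≗xw n = trans (⊛-cong {g} (λ _ → refl) numerator-1/x n) (trans (⊛-identityʳ g n) (g≗xw n))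

  ≐-1/x* : ∀ u {w} → g · u ≐ (x^ 1 · w) → g · (1/x * u) ≐ w
  ≐-1/x* (f ÷x^ p) {w} gu n = begin
    (g ⊛ (numerator 1/x ⊛ f)) n
      ≡⟨ ⊛-cong {g} (λ _ → refl) (λ i → trans (⊛-cong {g = f} numerator-1/x (λ _ → refl) i) (⊛-identityˡ f i)) n ⟩
    (g ⊛ f) n              ≡⟨ gu n ⟩
    (x^ p · (x^ 1 · w)) n  ≡⟨ x^-comm p 1 w n ⟩
    (x^ 1 · (x^ p · w)) n  ≡⟨ x^-+ 1 p w n ⟨
    (x^ (1 + p) · w) n     ∎
    where open ≡-Reasoning

-- Walks

if-true : ∀ {A : Set} {b} {p q : A} → T b → (if b then p else q) ≡ p
if-true {b = true} _ = refl

<ᵇ-irrefl : ∀ k {A : Set} {p q : A} → (if k <ᵇ k then p else q) ≡ q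
<ᵇ-irrefl k with k <ᵇ k in eq
... | true  = contradiction (<ᵇ⇒< k k (subst T (sym eq) _)) (n≮n k)
... | false = refl

-- A step of a nearest-neighbour walk on the vertices 1, …, k.
step : ℕ → (ℕ → ℕ) → ℕ → ℕ
step k f zero    = 0
step k f (suc l) = if l <ᵇ k then f l + f (2 + l) else 0

step-< : ∀ {k l} f → l < k → step k f (suc l) ≡ f l + f (2 + l)
step-< f l<k = if-true (<⇒<ᵇ l<k)

-- Walks of length n from the auxiliary vertex 0, which is never entered again, to l.
arrivals : ℕ → ℕ → ℕ → ℕ
arrivals k zero    zero    = 1
arrivals k zero    (suc l) = 0
arrivals k (suc n) l       = step k (arrivals k n) l

arrivals-end : ∀ k n → arrivals k n (suc k) ≡ 0
arrivals-end k zero    = refl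
arrivals-end k (suc n) = <ᵇ-irrefl k

fromℕ : ℕ → ℚ
fromℕ n = ℤ.+ n ℚ./ 1

fromℕ-+ : ∀ m n → fromℕ (m + n) ≡ fromℕ m ℚ.+ fromℕ n
fromℕ-+ m n = ℚₚ.toℚᵘ-injective (begin
  ℚ.toℚᵘ (fromℕ (m + n)) ≈⟨ ℚₚ.toℚᵘ-fromℚᵘ (mkℚᵘ (ℤ.+ (m + n)) 0) ⟩
  mkℚᵘ (ℤ.+ (m + n)) 0 ≈⟨ *≡* (cong (ℤ._* ℤ.1ℤ) (sym (cong₂ ℤ._+_ (ℤₚ.*-identityʳ (ℤ.+ m)) (ℤₚ.*-identityʳ (ℤ.+ n))))) ⟩
  mkℚᵘ (ℤ.+ m) 0 ℚᵘ.+ mkℚᵘ (ℤ.+ n) 0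
    ≈⟨ ℚᵘₚ.+-cong (ℚₚ.toℚᵘ-fromℚᵘ (mkℚᵘ (ℤ.+ m) 0)) (ℚₚ.toℚᵘ-fromℚᵘ (mkℚᵘ (ℤ.+ n) 0)) ⟨
  ℚ.toℚᵘ (fromℕ m) ℚᵘ.+ ℚ.toℚᵘ (fromℕ n) ≈⟨ ℚₚ.toℚᵘ-homo-+ (fromℕ m) (fromℕ n) ⟨
  ℚ.toℚᵘ (fromℕ m ℚ.+ fromℕ n) ∎)
  where
  open import Relation.Binary.Reasoning.Setoid ℚᵘₚ.≃-setoid
  open ℚᵘ using (mkℚᵘ; *≡*)

∑ : ℕ → (ℕ → ℕ) → ℕ
∑ zero    f = 0
∑ (suc l) f = f l + ∑ l f

∑-cong : ∀ l {f g} → (∀ i → i < l → f i ≡ g i) → ∑ l f ≡ ∑ l g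
∑-cong zero    eq = refl
∑-cong (suc l) eq = cong₂ _+_ (eq l ≤-refl) (∑-cong l λ i i<l → eq i (m<n⇒m<1+n i<l))

∑-zero : ∀ l {f} → (∀ i → f i ≡ 0) → ∑ l f ≡ 0
∑-zero zero    eq = refl
∑-zero (suc l) eq = cong₂ _+_ (eq l) (∑-zero l eq)

-- Walks of length n from l to any vertex.
departures : ℕ → ℕ → ℕ → ℕ
departures k zero    zero    = 0
departures k zero    (suc l) = if l <ᵇ k then 1 else 0
departures k (suc n) l       = step k (departures k n) l

departures-0 : ∀ k n → departures k n 0 ≡ 0
departures-0 k zero    = refl
departures-0 k (suc n) = refl

departures-end : ∀ k n → departures k n (suc k) ≡ 0
departures-end k zero    = <ᵇ-irrefl k
departures-end k (suc n) = <ᵇ-irrefl k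

-- The adjacency matrix of a path is symmetric. The four zeros silence the edges that join the path
-- to `0` and to `suc k`.
step-adjoint : ∀ k {f g} → f 0 ≡ 0 → g 0 ≡ 0 → f (suc k) ≡ 0 → g (suc k) ≡ 0 →
  ∑ k (λ l → step k f (suc l) ℕ.* g (suc l)) ≡ ∑ k (λ l → f (suc l) ℕ.* step k g (suc l))
step-adjoint k {f} {g} f₀ g₀ f₁ g₁ = begin
  ∑ k (λ l → step k f (suc l) ℕ.* g (suc l))
    ≡⟨ ∑-cong k (λ l l<k → cong (ℕ._* g (suc l)) (step-< f l<k)) ⟩
  A k                                       ≡⟨ +-identityʳ (A k) ⟨
  A k + 0                                   ≡⟨ cong (A k +_) (zeros {a = f k} {b = f 1} g₁ g₀) ⟨
  A k + (f k ℕ.* g (suc k) + f 1 ℕ.* g 0)       ≡⟨ boundary k ⟩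
  B k + (g k ℕ.* f (suc k) + g 1 ℕ.* f 0)       ≡⟨ cong (B k +_) (zeros {a = g k} {b = g 1} f₁ f₀) ⟩
  B k + 0                                   ≡⟨ +-identityʳ (B k) ⟩
  B k
    ≡⟨ ∑-cong k (λ l l<k → cong (f (suc l) ℕ.*_) (step-< g l<k)) ⟨
  ∑ k (λ l → f (suc l) ℕ.* step k g (suc l))  ∎
  where
  open ≡-Reasoning
  A B : ℕ → ℕ
  A k = ∑ k (λ l → (f l + f (2 + l)) ℕ.* g (suc l))
  B k = ∑ k (λ l → f (suc l) ℕ.* (g l + g (2 + l)))
  zeros : ∀ {a b c d} → c ≡ 0 → d ≡ 0 → a ℕ.* c + b ℕ.* d ≡ 0
  zeros {a} {b} refl refl = cong₂ _+_ (*-zeroʳ a) (*-zeroʳ b)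
  -- A discrete Green identity. The boundary terms are kept because the induction runs over all
  -- upper limits, while `f` and `g` vanish only beyond the full path.
  boundary : ∀ k → A k + (f k ℕ.* g (suc k) + f 1 ℕ.* g 0) ≡ B k + (g k ℕ.* f (suc k) + g 1 ℕ.* f 0)
  boundary zero    = trans (+-comm (f 0 ℕ.* g 1) (f 1 ℕ.* g 0)) (cong₂ _+_ (*-comm (f 1) (g 0)) (*-comm (f 0) (g 1)))
  boundary (suc k) = begin
    (f k + f (2 + k)) ℕ.* g (suc k) + A k + (f (suc k) ℕ.* g (2 + k) + f 1 ℕ.* g 0)
      ≡⟨ solve 7 (λ a b c A d e r → (a :+ b) :* c :+ A :+ (d :* e :+ r)
                  := A :+ (a :* c :+ r) :+ (d :* e :+ c :* b)) refl
           (f k) (f (2 + k)) (g (suc k)) (A k) (f (suc k)) (g (2 + k)) (f 1 ℕ.* g 0) ⟩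
    A k + (f k ℕ.* g (suc k) + f 1 ℕ.* g 0) + (f (suc k) ℕ.* g (2 + k) + g (suc k) ℕ.* f (2 + k))
      ≡⟨ cong (_+ (f (suc k) ℕ.* g (2 + k) + g (suc k) ℕ.* f (2 + k))) (boundary k) ⟩
    B k + (g k ℕ.* f (suc k) + g 1 ℕ.* f 0) + (f (suc k) ℕ.* g (2 + k) + g (suc k) ℕ.* f (2 + k))
      ≡⟨ solve 6 (λ B a b r c d → B :+ (a :* b :+ r) :+ (b :* c :+ d)
                  := b :* (a :+ c) :+ B :+ (d :+ r)) refl
           (B k) (g k) (f (suc k)) (g 1 ℕ.* f 0) (g (2 + k)) (g (suc k) ℕ.* f (2 + k)) ⟩
    f (suc k) ℕ.* (g k + g (2 + k)) + B k + (g (suc k) ℕ.* f (2 + k) + g 1 ℕ.* f 0) ∎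
    where open +-*-Solver

-- By adjointness of `step`, the steps pass one at a time from the arriving half of a walk to the
-- departing half. The exchange stops at `arrivals k 1`, since `step-adjoint` wants a zero at vertex
-- 0 and `arrivals k 0` is 1 there.
arrivals-departures : ∀ k m n →
  ∑ k (λ l → arrivals k (suc m) (suc l) ℕ.* departures k n (suc l)) ≡
  ∑ k (λ l → arrivals k 1 (suc l) ℕ.* departures k (m + n) (suc l))
arrivals-departures k zero    n = refl
arrivals-departures k (suc m) n = begin
  ∑ k (λ l → arrivals k (2 + m) (suc l) ℕ.* departures k n (suc l))
    ≡⟨ step-adjoint k {arrivals k (suc m)} {departures k n} refl (departures-0 k n)
         (arrivals-end k (suc m)) (departures-end k n) ⟩
  ∑ k (λ l → arrivals k (suc m) (suc l) ℕ.* departures k (suc n) (suc l))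
    ≡⟨ arrivals-departures k m (suc n) ⟩
  ∑ k (λ l → arrivals k 1 (suc l) ℕ.* departures k (m + suc n) (suc l))
    ≡⟨ cong (λ p → ∑ k (λ l → arrivals k 1 (suc l) ℕ.* departures k p (suc l))) (+-suc m n) ⟩
  ∑ k (λ l → arrivals k 1 (suc l) ℕ.* departures k (suc m + n) (suc l)) ∎
  where open ≡-Reasoning

arrivals-1 : ∀ k (g : ℕ → ℕ) → 1 ≤ k → ∑ k (λ l → arrivals k 1 (suc l) ℕ.* g l) ≡ g 0
arrivals-1 (suc k) g _ = trans (∑-cong (suc k) λ l l<k → cong (ℕ._* g l) (step-< (arrivals (suc k) 0) l<k)) (go k)
  where
  go : ∀ m → ∑ (suc m) (λ l → (arrivals (suc k) 0 l + 0) ℕ.* g l) ≡ g 0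
  go zero    = trans (+-identityʳ (1 ℕ.* g 0)) (*-identityˡ (g 0))
  go (suc m) = go m

-- The weight `departures k 0` is 1 on the vertices of the path, so the sum is a pairing of arrivals
-- with departures. After the exchange, `arrivals k 1` is concentrated at vertex 1. The shift from
-- `suc n` to `n` is the step out of vertex 0.
∑-arrivals : ∀ k n → 1 ≤ k → ∑ k (λ l → arrivals k (suc n) (suc l)) ≡ departures k n 1
∑-arrivals k n 1≤k = begin
  ∑ k (λ l → arrivals k (suc n) (suc l))
    ≡⟨ ∑-cong k (λ l l<k → trans (cong (arrivals k (suc n) (suc l) ℕ.*_) (if-true (<⇒<ᵇ l<k))) (*-identityʳ _)) ⟨
  ∑ k (λ l → arrivals k (suc n) (suc l) ℕ.* departures k 0 (suc l))
    ≡⟨ arrivals-departures k n 0 ⟩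
  ∑ k (λ l → arrivals k 1 (suc l) ℕ.* departures k (n + 0) (suc l))
    ≡⟨ arrivals-1 k (λ l → departures k (n + 0) (suc l)) 1≤k ⟩
  departures k (n + 0) 1 ≡⟨ cong (λ m → departures k m 1) (+-identityʳ n) ⟩
  departures k n 1 ∎
  where open ≡-Reasoning

-- Generating functions of walks and Chebyshev polynomials

module _ (k : ℕ) where

  Arrivals : ℕ → PowerSeries
  Arrivals l n = fromℕ (arrivals k n l)

  Arrivals-0 : Arrivals 0 ≗ constant 1ℚ
  Arrivals-0 zero    = refl
  Arrivals-0 (suc n) = refl

  -- Starting at the auxiliary vertex 0 makes the recurrence hold at vertex 1 as well, with
  -- `Arrivals 0`, the constant 1, as its source term. The price is an extra factor `x`.
  Arrivals-suc : ∀ {l} → l < k → Arrivals (suc l) ≗ x^ 1 · (Arrivals l ⊕ Arrivals (2 + l))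
  Arrivals-suc l<k zero = refl
  Arrivals-suc {l} l<k (suc n) = trans (cong fromℕ (step-< (arrivals k n) l<k))
    (fromℕ-+ (arrivals k n l) (arrivals k n (2 + l)))

  Arrivals-end : ∀ n → Arrivals (suc k) n ≡ 0ℚ
  Arrivals-end n = cong fromℕ (arrivals-end k n)

  open Multiples (Arrivals k)

  -- Solved for `Arrivals l`, the walk recurrence is the Chebyshev one: `1/x` times
  -- `Arrivals (suc l)`, minus `Arrivals (2 + l)`. The vanishing of `Arrivals (suc k)` corresponds
  -- to U of index -1 being 0. For `l = 0` the lemma makes `Arrivals k` the inverse of `U k ½x⁻¹`.
  ≐-U : ∀ a l → a + l ≡ k → Arrivals k · U a ½x⁻¹ ≐ Arrivals l
  ≐-U 0 l refl = ≐-1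
  ≐-U 1 l refl = ≐-1/x λ n → trans (Arrivals-suc ≤-refl n)
    (x^-cong 1 (λ i → trans (cong (Arrivals l i ℚ.+_) (Arrivals-end i)) (ℚₚ.+-identityʳ _)) n)
  ≐-U (2+ a) l eq = ≐-resp-≗ (1/x * U (suc a) ½x⁻¹ +ᴸ -ᴸ U a ½x⁻¹) cancel
    (≐-+ (1/x * U (suc a) ½x⁻¹) (-ᴸ U a ½x⁻¹)
      (≐-1/x* (U (suc a) ½x⁻¹) (≐-resp-≗ (U (suc a) ½x⁻¹) (Arrivals-suc l<k)
        (≐-U (suc a) (suc l) (trans (cong suc (+-suc a l)) eq))))
      (≐-neg (U a ½x⁻¹) (≐-U a (2 + l) (trans (+-suc a (suc l)) (trans (cong suc (+-suc a l)) eq)))))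
    where
    l<k : l < k
    l<k = subst (l <_) eq (s≤s (m≤n+m l (suc a)))
    cancel : ∀ n → Arrivals l n ℚ.+ Arrivals (2 + l) n ℚ.+ ℚ.- Arrivals (2 + l) n ≡ Arrivals l n
    cancel n = trans (ℚₚ.+-assoc (Arrivals l n) _ _)
      (trans (cong (Arrivals l n ℚ.+_) (ℚₚ.+-inverseʳ (Arrivals (2 + l) n))) (ℚₚ.+-identityʳ _))

  -- The offset `a` grows as `sum` peels off its head. The family `u` is abstract and only pointwise
  -- equal to Chebyshev values, because `a + suc j` and `suc a + j` are not the same by computation.
  ≐-∑U : ∀ a l → a + l ≡ k → (u : Fin l → LaurentSeries) → (∀ j → u j ≡ U (a + toℕ j) ½x⁻¹) →
    Arrivals k · sum u ≐ λ n → fromℕ (∑ l λ i → arrivals k n (suc i))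
  ≐-∑U a zero    eq u u≡U n = trans (⊛-cong {Arrivals k} (λ _ → refl) zeros n) (⊛-0 (Arrivals k) n)
    where
    zeros : constant 0ℚ ≗ λ _ → 0ℚ
    zeros zero    = refl
    zeros (suc n) = refl
    ⊛-0 : ∀ f n → (f ⊛ (λ _ → 0ℚ)) n ≡ 0ℚ
    ⊛-0 f zero    = trans (ℚₚ.+-identityʳ _) (ℚₚ.*-zeroʳ (f 0))
    ⊛-0 f (suc n) = cong₂ ℚ._+_ (ℚₚ.*-zeroʳ (f 0)) (⊛-0 (f ∘ suc) n)
  ≐-∑U a (suc l) eq u u≡U = ≐-resp-≗ (sum u)
    (λ n → sym (fromℕ-+ (arrivals k n (suc l)) (∑ l λ i → arrivals k n (suc i))))
    (≐-+ (u zero) (sum (u ∘ suc))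
      (subst (λ v → Arrivals k · v ≐ Arrivals (suc l)) (sym (trans (u≡U zero) (cong (λ b → U b ½x⁻¹) (+-identityʳ a))))
        (≐-U a (suc l) eq))
      (≐-∑U (suc a) l (trans (sym (+-suc a l)) eq) (u ∘ suc)
        (λ j → trans (u≡U (suc j)) (cong (λ b → U b ½x⁻¹) (+-suc a (toℕ j))))))

  module _ (1≤k : 1 ≤ k) {a : ℕ → ℕ} (a≗ : ∀ n → a n ≡ departures k n 1) where

    ∑-Arrivals : ∀ n → fromℕ (∑ k λ i → arrivals k n (suc i)) ≡ (x^ 1 · (λ n → fromℕ (a n))) n
    ∑-Arrivals zero    = cong fromℕ (∑-zero k λ _ → refl)
    ∑-Arrivals (suc n) = cong fromℕ (trans (∑-arrivals k n 1≤k) (sym (a≗ n)))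

    generatingFunction-departures :
      ∃ λ r → (r * (x * U k ½x⁻¹) ≈ 1#)
            × (generatingFunction a ≈ r * sum (λ (j : Fin k) → U (toℕ j) ½x⁻¹))
    -- Dividing by `x` removes the step out of vertex 0 and leaves the walks from vertex 1 to vertex
    -- `k`.
    generatingFunction-departures = Arrivals k ÷x^ 1 , inverse , quotient
      where
      open ≡-Reasoning
      f = numerator (U k ½x⁻¹)
      p = poleOrder (U k ½x⁻¹)
      h = numerator (sum (λ (j : Fin k) → U (toℕ j) ½x⁻¹))
      q = poleOrder (sum (λ (j : Fin k) → U (toℕ j) ½x⁻¹))
      inverse : ∀ n → (Arrivals k ⊛ ((x^ 1 · constant 1ℚ) ⊛ f)) n ≡ (x^ (1 + p) · constant 1ℚ) n
      inverse n = begin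
        (Arrivals k ⊛ ((x^ 1 · constant 1ℚ) ⊛ f)) n ≡⟨ ⊛-cong {Arrivals k} (λ _ → refl) (x·⊛ f) n ⟩
        (Arrivals k ⊛ (x^ 1 · f)) n ≡⟨ ⊛-x· (Arrivals k) f n ⟩
        (x^ 1 · (Arrivals k ⊛ f)) n ≡⟨ x^-cong 1 (≐-resp-≗ (U k ½x⁻¹) Arrivals-0 (≐-U k 0 (+-identityʳ k))) n ⟩
        (x^ 1 · (x^ p · constant 1ℚ)) n ≡⟨ x^-+ 1 p (constant 1ℚ) n ⟨
        (x^ (1 + p) · constant 1ℚ) n ∎
      quotient : ∀ n → (x^ (1 + q) · (λ n → fromℕ (a n))) n ≡ (Arrivals k ⊛ h) n
      quotient n = begin
        (x^ (1 + q) · (λ n → fromℕ (a n))) n ≡⟨ x^-+ 1 q _ n ⟩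
        (x^ 1 · (x^ q · (λ n → fromℕ (a n)))) n ≡⟨ x^-comm 1 q _ n ⟩
        (x^ q · (x^ 1 · (λ n → fromℕ (a n)))) n ≡⟨ x^-cong q ∑-Arrivals n ⟨
        (x^ q · (λ n → fromℕ (∑ k λ i → arrivals k n (suc i)))) n
          ≡⟨ ≐-∑U 0 k refl (λ j → U (toℕ j) ½x⁻¹) (λ _ → refl) n ⟨
        (Arrivals k ⊛ h) n ∎

-- Pattern occurrences

private
  variable
    k m n : ℕ

Increasing : (Fin k → Fin n) → Set
Increasing p = ∀ {a b} → a Fin.< b → p a Fin.< p b

-- One implication is enough: the values of a permutation are distinct and linearly ordered, so
-- preserving the order of `τ` also reflects it.
record Occurrence (α : Permutation′ n) (τ : Permutation′ k) : Set where
  field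
    position   : Fin k → Fin n
    increasing : Increasing position
    monotone   : ∀ {a b} → τ ⟨$⟩ʳ a Fin.< τ ⟨$⟩ʳ b →
                 α ⟨$⟩ʳ position a Fin.< α ⟨$⟩ʳ position b

contains⇒occurrence : {α : Permutation′ n} {τ : Permutation′ k} → α Contains τ → Occurrence α τ
contains⇒occurrence (is , inc , iso) = record
  { position   = lookup is
  ; increasing = λ {a} {b} → inc a b
  ; monotone   = λ {a} {b} → Equivalence.from (iso a b)
  }

⟨$⟩ʳ-injective : (α : Permutation′ n) → ∀ {i j} → α ⟨$⟩ʳ i ≡ α ⟨$⟩ʳ j → i ≡ j
⟨$⟩ʳ-injective α {i} {j} eq = trans (sym (inverseˡ α)) (trans (cong (Inverse.from α) eq) (inverseˡ α))

occurrence⇒contains : {α : Permutation′ n} {τ : Permutation′ k} → Occurrence α τ → α Contains τ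
occurrence⇒contains {α = α} {τ} o = tabulate position
  , (λ a b a<b → subst₂ Fin._<_ (sym (lookup∘tabulate position a)) (sym (lookup∘tabulate position b)) (increasing a<b))
  , λ a b → subst₂ (λ i j → (α ⟨$⟩ʳ i) Fin.< (α ⟨$⟩ʳ j) ⇔ (τ ⟨$⟩ʳ a) Fin.< (τ ⟨$⟩ʳ b))
      (sym (lookup∘tabulate position a)) (sym (lookup∘tabulate position b))
      (mk⇔ (reflects a b) monotone)
  where
  open Occurrence o
  reflects : ∀ a b → α ⟨$⟩ʳ position a Fin.< α ⟨$⟩ʳ position b → τ ⟨$⟩ʳ a Fin.< τ ⟨$⟩ʳ b
  reflects a b αa<αb with Finₚ.<-cmp (τ ⟨$⟩ʳ a) (τ ⟨$⟩ʳ b)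
  ... | tri< τa<τb _ _ = τa<τb
  ... | tri> _ _ τb<τa = contradiction (monotone τb<τa) (<-asym αa<αb)
  ... | tri≈ _ τa≡τb _ rewrite ⟨$⟩ʳ-injective τ τa≡τb = contradiction αa<αb (n≮n _)

occurrence-cong : {α β : Permutation′ n} {τ : Permutation′ k} → α ≈ₚ β → Occurrence α τ → Occurrence β τ
occurrence-cong α≈β o = record
  { position   = position
  ; increasing = increasing
  ; monotone   = λ lt → subst₂ Fin._<_ (α≈β _) (α≈β _) (monotone lt)
  }
  where open Occurrence o

Has132 : Permutation′ n → Set
Has132 {n} α = ∃ λ (a : Fin n) → ∃ λ (b : Fin n) → ∃ λ (c : Fin n) →
  a Fin.< b × b Fin.< c × α ⟨$⟩ʳ a Fin.< α ⟨$⟩ʳ c × α ⟨$⟩ʳ c Fin.< α ⟨$⟩ʳ b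

occurrence⇒has132 : {α : Permutation′ n} → Occurrence α pattern132 → Has132 α
occurrence⇒has132 o = position 0F , position 1F , position 2F ,
  increasing {0F} {1F} z<s , increasing {1F} {2F} (s<s z<s) , monotone {0F} {2F} z<s , monotone {2F} {1F} (s<s z<s)
  where open Occurrence o

has132⇒occurrence : {α : Permutation′ n} → Has132 α → Occurrence α pattern132
has132⇒occurrence {n} {α} (a , b , c , a<b , b<c , αa<αc , αc<αb) = record
  { position   = p
  ; increasing = λ {i} {j} → inc i j
  ; monotone   = λ {i} {j} → mon i j
  }
  where
  p : Fin 3 → Fin n
  p 0F = a
  p 1F = b
  p 2F = c
  inc : ∀ i j → i Fin.< j → p i Fin.< p j
  inc 0F 1F _ = a<b
  inc 0F 2F _ = <-trans a<b b<c
  inc 1F 2F _ = b<c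
  inc 1F 1F lt = contradiction lt (n≮n 1)
  inc 2F 1F (s≤s ())
  inc 2F 2F (s≤s (s≤s ()))
  mon : ∀ i j → pattern132 ⟨$⟩ʳ i Fin.< pattern132 ⟨$⟩ʳ j → α ⟨$⟩ʳ p i Fin.< α ⟨$⟩ʳ p j
  mon 0F 1F _ = <-trans αa<αc αc<αb
  mon 0F 2F _ = αa<αc
  mon 2F 1F _ = αc<αb
  mon 2F 2F lt = contradiction lt (n≮n 1)
  mon 1F 1F lt = contradiction lt (n≮n 2)
  mon 1F 2F (s≤s ())

-- The values 2, 1, 3, …, k are 1, 0, 2, …, k-1 here; the remaining inequalities follow.
record Has213⋯ (m : ℕ) (α : Permutation′ n) : Set where
  field
    position   : Fin (3 + m) → Fin n
    increasing : Increasing position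
    descent    : α ⟨$⟩ʳ position 1F Fin.< α ⟨$⟩ʳ position 0F
    above      : ∀ t → α ⟨$⟩ʳ position 0F Fin.< α ⟨$⟩ʳ position (suc (suc t))
    rising     : ∀ {s t : Fin (suc m)} → s Fin.< t →
                 α ⟨$⟩ʳ position (suc (suc s)) Fin.< α ⟨$⟩ʳ position (suc (suc t))

occurrence⇒has213⋯ : {α : Permutation′ n} → Occurrence α (pattern213⋯ (3 + m)) → Has213⋯ m α
occurrence⇒has213⋯ {m = m} o = record
  { position   = position
  ; increasing = increasing
  ; descent    = monotone {1F} {0F} z<s
  ; above      = λ t → monotone {0F} {suc (suc t)} (s<s z<s)
  ; rising     = λ {s} {t} s<t → monotone {suc (suc s)} {suc (suc t)} (s<s (s<s s<t))
  }
  where open Occurrence o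

has213⋯⇒occurrence : {α : Permutation′ n} → Has213⋯ m α → Occurrence α (pattern213⋯ (3 + m))
has213⋯⇒occurrence {m = m} {α} o = record
  { position   = position
  ; increasing = increasing
  ; monotone   = λ {a} {b} → mon a b
  }
  where
  open Has213⋯ o
  τ = pattern213⋯ (3 + m)
  mon : ∀ a b → τ ⟨$⟩ʳ a Fin.< τ ⟨$⟩ʳ b → α ⟨$⟩ʳ position a Fin.< α ⟨$⟩ʳ position b
  mon 0F            0F            lt = contradiction lt (n≮n 1)
  mon 0F            (suc (suc t)) _  = above t
  mon 1F            0F            _  = descent
  mon 1F            (suc (suc t)) _  = <-trans descent (above t)
  mon (suc (suc s)) 0F            (s≤s ())
  mon (suc (suc s)) (suc (suc t)) lt = rising (s<s⁻¹ (s<s⁻¹ lt))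

-- Involutions

SelfInverse : Permutation′ n → Set
SelfInverse α = ∀ i → α ⟨$⟩ʳ (α ⟨$⟩ʳ i) ≡ i

involution⇒selfInverse : (α : Permutation′ n) → Involution α → SelfInverse α
involution⇒selfInverse α inv i = trans (cong (α ⟨$⟩ʳ_) (inv i)) (inverseʳ α)

selfInverse⇒involution : (α : Permutation′ n) → SelfInverse α → Involution α
selfInverse⇒involution α self i = ⟨$⟩ʳ-injective α (trans (self i) (sym (inverseʳ α)))

-- The value 0 at size 0 places the empty permutation among the identities, which are the avoiding
-- involutions with first entry 0.
first : Permutation′ n → ℕ
first {zero}  α = 0
first {suc n} α = toℕ (α ⟨$⟩ʳ 0F)

first-cong : {α β : Permutation′ n} → α ≈ₚ β → first α ≡ first β
first-cong {zero}  α≈β = refl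
first-cong {suc n} α≈β = cong toℕ (α≈β 0F)

first-< : (α : Permutation′ n) → first α < suc n
first-< {zero}  α = z<s
first-< {suc n} α = m<n⇒m<1+n (Finₚ.toℕ<n (α ⟨$⟩ʳ 0F))

punchIn-mono-< : ∀ (i : Fin (suc n)) j k → j Fin.< k → punchIn i j Fin.< punchIn i k
punchIn-mono-< zero    j       k       j<k = s<s j<k
punchIn-mono-< (suc i) zero    (suc k) _   = z<s
punchIn-mono-< (suc i) (suc j) (suc k) j<k = s<s (punchIn-mono-< i j k (s<s⁻¹ j<k))

punchIn-cancel-< : ∀ (i : Fin (suc n)) j k → punchIn i j Fin.< punchIn i k → j Fin.< k
punchIn-cancel-< i j k lt = ≰⇒> λ k≤j → <⇒≱ lt (Finₚ.punchIn-mono-≤ i k j k≤j)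

punchIn-< : ∀ (i : Fin (suc n)) j → toℕ j < toℕ i → toℕ (punchIn i j) ≡ toℕ j
punchIn-< (suc i) zero    _   = refl
punchIn-< (suc i) (suc j) j<i = cong suc (punchIn-< i j (s<s⁻¹ j<i))

punchIn-≥ : ∀ (i : Fin (suc n)) j → toℕ i ≤ toℕ j → toℕ (punchIn i j) ≡ suc (toℕ j)
punchIn-≥ zero    j       _   = refl
punchIn-≥ (suc i) (suc j) i≤j = cong suc (punchIn-≥ i j (s≤s⁻¹ i≤j))

punchIn->⁻¹ : ∀ (i : Fin (suc n)) j → toℕ i < toℕ (punchIn i j) → toℕ i ≤ toℕ j
punchIn->⁻¹ i j lt = ≮⇒≥ λ j<i → <-asym lt (subst (_< toℕ i) (sym (punchIn-< i j j<i)) j<i)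

punchIn-<⁻¹ : ∀ (i : Fin (suc n)) j → toℕ (punchIn i j) < toℕ i → toℕ j < toℕ i
punchIn-<⁻¹ i j lt = ≰⇒> λ i≤j →
  <-asym lt (subst (toℕ i <_) (sym (punchIn-≥ i j i≤j)) (s≤s i≤j))

-- Adds the 2-cycle (0 suc j) to π.
addCycle : Fin (suc n) → Permutation′ n → Permutation′ (2 + n)
addCycle j π = insert 0F (suc j) (insert j 0F π)

addCycle-cong : (j : Fin (suc n)) {π ρ : Permutation′ n} → π ≈ₚ ρ → addCycle j π ≈ₚ addCycle j ρ

module _ {n} (j : Fin (suc n)) where

  embed : Fin n → Fin (2 + n)
  embed a = suc (punchIn j a)

  embed-injective : ∀ {a b} → embed a ≡ embed b → a ≡ b
  embed-injective eq = Finₚ.punchIn-injective j _ _ (Finₚ.suc-injective eq)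

  data View : Fin (2 + n) → Set where
    start : View 0F
    end   : View (suc j)
    rest  : ∀ a → View (embed a)

  view : ∀ p → View p
  view zero    = start
  view (suc q) with j Finₚ.≟ q
  ... | yes refl = end
  ... | no  j≢q  = subst (View ∘ suc) (Finₚ.punchIn-punchOut j≢q) (rest (punchOut j≢q))

  module _ (π : Permutation′ n) where

    private α = addCycle j π

    addCycle-end : α ⟨$⟩ʳ suc j ≡ 0F
    addCycle-end with j Finₚ.≟ j
    ... | yes _   = refl
    ... | no  j≢j = contradiction refl j≢j

    addCycle-rest : ∀ a → α ⟨$⟩ʳ embed a ≡ embed (π ⟨$⟩ʳ a)
    addCycle-rest a = cong (punchIn (suc j)) (insert-punchIn j 0F π a)

    addCycle-selfInverse : SelfInverse π → SelfInverse α
    addCycle-selfInverse self p with view p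
    ... | start  = addCycle-end
    ... | end    = cong (α ⟨$⟩ʳ_) addCycle-end
    ... | rest a = begin
      α ⟨$⟩ʳ (α ⟨$⟩ʳ embed a)      ≡⟨ cong (α ⟨$⟩ʳ_) (addCycle-rest a) ⟩
      α ⟨$⟩ʳ embed (π ⟨$⟩ʳ a)      ≡⟨ addCycle-rest (π ⟨$⟩ʳ a) ⟩
      embed (π ⟨$⟩ʳ (π ⟨$⟩ʳ a))    ≡⟨ cong embed (self a) ⟩
      embed a                      ∎
      where open ≡-Reasoning

    addCycle-selfInverse⁻¹ : SelfInverse α → SelfInverse π
    addCycle-selfInverse⁻¹ self a = embed-injective (begin
      embed (π ⟨$⟩ʳ (π ⟨$⟩ʳ a))    ≡⟨ addCycle-rest (π ⟨$⟩ʳ a) ⟨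
      α ⟨$⟩ʳ embed (π ⟨$⟩ʳ a)      ≡⟨ cong (α ⟨$⟩ʳ_) (addCycle-rest a) ⟨
      α ⟨$⟩ʳ (α ⟨$⟩ʳ embed a)      ≡⟨ self (embed a) ⟩
      embed a                      ∎)
      where open ≡-Reasoning

    addCycle-occurrence : {τ : Permutation′ k} → Occurrence π τ → Occurrence α τ
    addCycle-occurrence o = record
      { position   = embed ∘ position
      ; increasing = λ a<b → s<s (punchIn-mono-< j _ _ (increasing a<b))
      ; monotone   = λ lt → subst₂ Fin._<_ (sym (addCycle-rest _)) (sym (addCycle-rest _))
                              (s<s (punchIn-mono-< j _ _ (monotone lt)))
      }
      where open Occurrence o

addCycle-cong j {π} {ρ} π≈ρ p with view j p
... | start  = refl
... | end    = trans (addCycle-end j π) (sym (addCycle-end j ρ))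
... | rest a = trans (addCycle-rest j π a) (trans (cong (embed j) (π≈ρ a)) (sym (addCycle-rest j ρ a)))

addCycle-injective : (j : Fin (suc n)) {π ρ : Permutation′ n} → addCycle j π ≈ₚ addCycle j ρ → π ≈ₚ ρ
addCycle-injective j {π} {ρ} eq a = embed-injective j
  (trans (sym (addCycle-rest j π a)) (trans (eq (embed j a)) (addCycle-rest j ρ a)))

insert-cong : ∀ {m n} (i : Fin (suc m)) (j : Fin (suc n)) {π ρ} → π ≈ₚ ρ → insert i j π ≈ₚ insert i j ρ
insert-cong i j {π} {ρ} π≈ρ k with i Finₚ.≟ k
... | yes _ = refl
... | no  _ = cong (punchIn j) (π≈ρ _)

addCycle-complete : (α : Permutation′ (2 + n)) → SelfInverse α → ∀ {j} → α ⟨$⟩ʳ 0F ≡ suc j →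
  ∃ λ π → α ≈ₚ addCycle j π
addCycle-complete α self {j} α0≡1+j = remove j ρ , λ i → sym (begin
    insert 0F (suc j) (insert j 0F (remove j ρ)) ⟨$⟩ʳ i
      ≡⟨ insert-cong 0F (suc j) {insert j 0F (remove j ρ)} {ρ} ≈ρ i ⟩
    insert 0F (suc j) ρ ⟨$⟩ʳ i
      ≡⟨ cong (λ k → insert 0F k ρ ⟨$⟩ʳ i) α0≡1+j ⟨
    insert 0F (α ⟨$⟩ʳ 0F) ρ ⟨$⟩ʳ i
      ≡⟨ insert-remove 0F α i ⟩
    α ⟨$⟩ʳ i ∎)
  where
  open ≡-Reasoning
  ρ = remove 0F α
  ρj≡0 : ρ ⟨$⟩ʳ j ≡ 0F
  ρj≡0 = Finₚ.punchIn-injective (α ⟨$⟩ʳ 0F) _ _ (begin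
    punchIn (α ⟨$⟩ʳ 0F) (ρ ⟨$⟩ʳ j)      ≡⟨ insert-remove 0F α (suc j) ⟩
    α ⟨$⟩ʳ suc j                        ≡⟨ cong (α ⟨$⟩ʳ_) α0≡1+j ⟨
    α ⟨$⟩ʳ (α ⟨$⟩ʳ 0F)                  ≡⟨ self 0F ⟩
    0F                                  ≡⟨ cong (λ i → punchIn i 0F) α0≡1+j ⟨
    punchIn (α ⟨$⟩ʳ 0F) 0F              ∎)
  ≈ρ : insert j 0F (remove j ρ) ≈ₚ ρ
  ≈ρ i = trans (cong (λ k → insert j k (remove j ρ) ⟨$⟩ʳ i) (sym ρj≡0)) (insert-remove j ρ i)

-- Avoidance under adding a 2-cycle

growth : (f : Fin (suc n) → ℕ) → (∀ {a b} → a Fin.< b → f a < f b) → ∀ i → f 0F + toℕ i ≤ f i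
growth f inc zero    = ≤-reflexive (+-identityʳ _)
growth {suc n} f inc (suc i) = begin
  f 0F + suc (toℕ i)   ≡⟨ +-suc (f 0F) (toℕ i) ⟩
  suc (f 0F) + toℕ i   ≤⟨ +-monoˡ-≤ (toℕ i) (inc {0F} {1F} z<s) ⟩
  f 1F + toℕ i         ≤⟨ growth (f ∘ suc) (inc ∘ s<s) i ⟩
  f (suc i)            ∎
  where open ≤-Reasoning

growth-bound : ∀ {c} (f : Fin (suc m) → Fin n) → Increasing f → c < toℕ (f 0F) → c + suc m < n
growth-bound {m} {n} {c} f inc c<f₀ = begin-strict
  c + suc m                  ≡⟨ +-suc c m ⟩
  suc c + m                  ≡⟨ cong (suc c +_) (Finₚ.toℕ-fromℕ m) ⟨
  suc c + toℕ (Fin.fromℕ m)  ≤⟨ +-monoˡ-≤ _ c<f₀ ⟩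
  toℕ (f 0F) + toℕ (Fin.fromℕ m) ≤⟨ growth (toℕ ∘ f) inc (Fin.fromℕ m) ⟩
  toℕ (f (Fin.fromℕ m))      <⟨ Finₚ.toℕ<n _ ⟩
  n                          ∎
  where open ≤-Reasoning

module AddCycle (j : Fin (suc n)) (π : Permutation′ n) where

  α : Permutation′ (2 + n)
  α = addCycle j π

  e : Fin n → Fin (2 + n)
  e = embed j

  e-mono-< : ∀ {a b} → a Fin.< b → e a Fin.< e b
  e-mono-< a<b = s<s (punchIn-mono-< j _ _ a<b)

  e-cancel-< : ∀ {a b} → e a Fin.< e b → a Fin.< b
  e-cancel-< = punchIn-cancel-< j _ _ ∘ s<s⁻¹

  αe-< : ∀ {a b} → α ⟨$⟩ʳ e a Fin.< α ⟨$⟩ʳ e b → π ⟨$⟩ʳ a Fin.< π ⟨$⟩ʳ b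
  αe-< lt = e-cancel-< (subst₂ Fin._<_ (addCycle-rest j π _) (addCycle-rest j π _) lt)

  ≮αend : ∀ {p : Fin (2 + n)} → ¬ (p Fin.< α ⟨$⟩ʳ suc j)
  ≮αend {p} lt = n≮0 (subst (p Fin.<_) (addCycle-end j π) lt)

-- Position `0` is leftmost and `suc j` carries the value 0, so either can only be the 1 of a 132.
-- The bound on `first π` lets the first entry of `π` replace the former, and the entry 0 of `π`, at
-- position `i`, replace the latter.
addCycle-has132⁻ : (j : Fin (suc n)) (π : Permutation′ n) → SelfInverse π →
  first π ≤ toℕ j → Has132 (addCycle j π) → Has132 π
addCycle-has132⁻ {zero} zero π self _ (suc zero , suc zero , _ , s≤s () , _)
addCycle-has132⁻ {zero} zero π self _ (zero , suc zero , suc zero , _ , s≤s () , _)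
addCycle-has132⁻ {suc n} j π self first≤j (a′ , b′ , c′ , a<b , b<c′ , αa<αc , αc<αb) =
  go (view j a′) (view j b′) (view j c′) a<b b<c′ αa<αc αc<αb
  where
  open AddCycle j π
  i = π ⟨$⟩ʳ 0F
  go : ∀ {a b c} → View j a → View j b → View j c → a Fin.< b → b Fin.< c →
       α ⟨$⟩ʳ a Fin.< α ⟨$⟩ʳ c → α ⟨$⟩ʳ c Fin.< α ⟨$⟩ʳ b → Has132 π
  go _ start _ () _ _ _
  go _ _ start _ () _ _
  go _ end _ _ _ _ lt = contradiction lt ≮αend
  go _ _ end _ _ lt _ = contradiction lt ≮αend
  go (rest a) (rest b) (rest c) a<b b<c αa<αc αc<αb =
    a , b , c , e-cancel-< a<b , e-cancel-< b<c , αe-< αa<αc , αe-< αc<αb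
  go start (rest b) (rest c) _ eb<ec j<πc αc<αb = 0F , b , c , 0<b , b<c , i<πc , πc<πb
    where
    b<c : b Fin.< c
    b<c = e-cancel-< eb<ec
    πc<πb : π ⟨$⟩ʳ c Fin.< π ⟨$⟩ʳ b
    πc<πb = αe-< αc<αb
    i≤πc : toℕ i ≤ toℕ (π ⟨$⟩ʳ c)
    i≤πc = ≤-trans first≤j (punchIn->⁻¹ j _ (s<s⁻¹ (subst (suc j Fin.<_) (addCycle-rest j π c) j<πc)))
    0<b : 0 < toℕ b
    0<b = n≢0⇒n>0 λ b≡0 → <⇒≱ πc<πb
      (subst (λ b → toℕ (π ⟨$⟩ʳ b) ≤ toℕ (π ⟨$⟩ʳ c)) (Finₚ.toℕ-injective {i = 0F} (sym b≡0)) i≤πc)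
    i<πc : toℕ i < toℕ (π ⟨$⟩ʳ c)
    i<πc = ≤∧≢⇒< i≤πc λ eq → m<n⇒n≢0 b<c
      (cong toℕ (sym (⟨$⟩ʳ-injective π (Finₚ.toℕ-injective eq))))
  go end (rest b) (rest c) j<eb eb<ec _ αc<αb = i , b , c , i<b , b<c , πi<πc , πc<πb
    where
    b<c : b Fin.< c
    b<c = e-cancel-< eb<ec
    πc<πb : π ⟨$⟩ʳ c Fin.< π ⟨$⟩ʳ b
    πc<πb = αe-< αc<αb
    i<b : toℕ i < toℕ b
    i<b = ≤∧≢⇒< (≤-trans first≤j (punchIn->⁻¹ j b (s<s⁻¹ j<eb))) λ eq →
      m<n⇒n≢0 πc<πb (cong toℕ (trans (cong (π ⟨$⟩ʳ_) (sym (Finₚ.toℕ-injective eq))) (self 0F)))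
    πi<πc : π ⟨$⟩ʳ i Fin.< π ⟨$⟩ʳ c
    πi<πc = subst (λ z → toℕ z < toℕ (π ⟨$⟩ʳ c)) (sym (self 0F)) (n≢0⇒n>0 λ πc≡0 →
      <-irrefl (cong toℕ (trans (cong (π ⟨$⟩ʳ_) (sym (Finₚ.toℕ-injective {j = 0F} πc≡0))) (self c)))
        (<-trans i<b b<c))

addCycle-has132⁺ : (j : Fin (suc n)) (π : Permutation′ n) → SelfInverse π →
  toℕ j < first π → Has132 (addCycle j π)
-- The last position is that of the value just above `suc j`, which lies below `e i`, the value at
-- `e 0F`.
addCycle-has132⁺ {suc n} j π self j<i = 0F , e 0F , e (π ⟨$⟩ʳ j′) ,
    z<s , e-mono-< 0<πj′ ,
    subst (suc j Fin.<_) (sym αeπj′) (s<s (subst (toℕ j <_) (sym (punchIn-≥ j j′ j≤j′)) (s≤s j≤j′))) ,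
    subst₂ Fin._<_ (sym αeπj′) (sym (addCycle-rest j π 0F)) (e-mono-< j′<i)
  where
  open AddCycle j π
  j<1+n : toℕ j < suc n
  j<1+n = <-trans j<i (Finₚ.toℕ<n (π ⟨$⟩ʳ 0F))
  j′ : Fin (suc n)
  j′ = fromℕ< j<1+n
  toℕj′≡j : toℕ j′ ≡ toℕ j
  toℕj′≡j = Finₚ.toℕ-fromℕ< j<1+n
  j≤j′ : toℕ j ≤ toℕ j′
  j≤j′ = ≤-reflexive (sym toℕj′≡j)
  j′<i : toℕ j′ < first π
  j′<i = subst (_< first π) (sym toℕj′≡j) j<i
  αeπj′ : α ⟨$⟩ʳ e (π ⟨$⟩ʳ j′) ≡ e j′
  αeπj′ = trans (addCycle-rest j π _) (cong e (self j′))
  0<πj′ : 0 < toℕ (π ⟨$⟩ʳ j′)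
  0<πj′ = n≢0⇒n>0 λ πj′≡0 → <-irrefl (cong toℕ (trans (sym (self j′))
    (cong (π ⟨$⟩ʳ_) (Finₚ.toℕ-injective {j = 0F} πj′≡0)))) j′<i

module _ (j : Fin (2 + n)) (π : Permutation′ (suc n)) (self : SelfInverse π)
         (j≡first : toℕ j ≡ first π) (0<j : 0 < toℕ j) where

  open AddCycle j π
  private
    i : Fin (suc n)
    i = π ⟨$⟩ʳ 0F

  -- Merges 0 with e 0 and suc j with e i, which are adjacent and have adjacent values.
  data _↘_ : Fin (3 + n) → Fin (suc n) → Set where
    start : 0F ↘ 0F
    end   : suc j ↘ i
    rest  : ∀ a → e a ↘ a

  ↘-total : ∀ p → ∃ (p ↘_)
  ↘-total p with view j p
  ... | start  = 0F , start
  ... | end    = i , end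
  ... | rest a = a , rest a

  -- The 2-cycles `(0 suc j)` and `(e 0 e i)` of `α` both lie over the 2-cycle `(0 i)` of `π`. So a
  -- single relation serves positions and values alike.
  ↘-addCycle : ∀ {p a} → p ↘ a → (α ⟨$⟩ʳ p) ↘ (π ⟨$⟩ʳ a)
  ↘-addCycle start    = end
  ↘-addCycle end      = subst₂ _↘_ (sym (addCycle-end j π)) (sym (self 0F)) start
  ↘-addCycle (rest a) = subst (_↘ (π ⟨$⟩ʳ a)) (sym (addCycle-rest j π a)) (rest (π ⟨$⟩ʳ a))

  ↘-mono-< : ∀ {p q a b} → p ↘ a → q ↘ b → p Fin.< q →
    ¬ (p ≡ 0F × q ≡ e 0F) → ¬ (p ≡ suc j × q ≡ e i) → a Fin.< b
  ↘-mono-< start    end      _   _      _    = subst (0 <_) j≡first 0<j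
  ↘-mono-< start    (rest a) _   ≢start _    = n≢0⇒n>0 λ a≡0 →
    ≢start (refl , cong e (Finₚ.toℕ-injective {j = 0F} a≡0))
  ↘-mono-< end      end      j<j _      _    = contradiction j<j (n≮n _)
  ↘-mono-< end      (rest a) j<a _      ≢end = ≤∧≢⇒< (subst (_≤ toℕ a) j≡first (punchIn->⁻¹ j a (s<s⁻¹ j<a)))
    λ i≡a → ≢end (refl , cong e (Finₚ.toℕ-injective (sym i≡a)))
  ↘-mono-< (rest a) end      a<j _      _    = subst (toℕ a <_) j≡first (punchIn-<⁻¹ j a (s<s⁻¹ a<j))
  ↘-mono-< (rest a) (rest b) a<b _      _    = e-cancel-< a<b

  toℕ-e0 : toℕ (e 0F) ≡ 1
  toℕ-e0 = cong suc (punchIn-< j 0F 0<j)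

  end<ei : suc j Fin.< e i
  end<ei = s<s (subst (toℕ j <_) (sym (punchIn-≥ j i (≤-reflexive j≡first))) (s≤s (≤-reflexive j≡first)))

  before-e0 : ∀ {p q : Fin (3 + n)} → p Fin.< q → q ≡ e 0F → p ≡ 0F
  before-e0 {p} p<q refl = Finₚ.toℕ-injective (n<1⇒n≡0 (subst (toℕ p <_) toℕ-e0 p<q))

  -- Each merged pair is an ascent of adjacent entries. One pair holds the two leftmost positions,
  -- the other the two smallest values. Since 213...k begins with a descent formed by its two
  -- smallest values, an occurrence never uses both members of a pair, and merging keeps all its
  -- strict inequalities.
  merge-has213⋯ : Has213⋯ m α → Has213⋯ m π
  merge-has213⋯ {m} o = record
    { position   = c
    ; increasing = λ {a} {b} a<b → position-mono a b (increasing a<b)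
    ; descent    = value-mono 1F 0F descent
    ; above      = λ t → value-mono 0F (suc (suc t)) (above t)
    ; rising     = λ {s} {t} s<t → value-mono (suc (suc s)) (suc (suc t)) (rising s<t)
    }
    where
    open Has213⋯ o
    c : Fin (3 + m) → Fin (suc n)
    c a = proj₁ (↘-total (position a))
    position↘ : ∀ a → position a ↘ c a
    position↘ a = proj₂ (↘-total (position a))
    α-self : SelfInverse α
    α-self = addCycle-selfInverse j π self

    αe0 : α ⟨$⟩ʳ e 0F ≡ e i
    αe0 = addCycle-rest j π 0F
    αei : α ⟨$⟩ʳ e i ≡ e 0F
    αei = trans (addCycle-rest j π i) (cong e (self 0F))

    noStart : ∀ a b → ¬ (position a ≡ 0F × position b ≡ e 0F)
    noStart (suc a) b  (pa , _)  = n≮0 (subst (position 0F Fin.<_) pa (increasing {0F} {suc a} z<s))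
    noStart 0F 0F (p0 , pb)      = contradiction (trans (sym p0) pb) λ ()
    noStart 0F 1F (p0 , pb)      = <-asym end<ei
      (subst₂ Fin._<_ (trans (cong (α ⟨$⟩ʳ_) pb) αe0) (cong (α ⟨$⟩ʳ_) p0) descent)
    noStart 0F (suc (suc t)) (p0 , pb) = <-irrefl (cong toℕ (trans p0 (sym p1)))
      (increasing {0F} {1F} z<s)
      where
      p1 : position 1F ≡ 0F
      p1 = before-e0 (increasing {1F} {suc (suc t)} (s<s z<s)) pb

    -- `suc j` has value 0, so it is entry `1F` of the occurrence. `e i` has value 1, so it could
    -- only be entry `0F`, but it stands to the right of `suc j`.
    noEnd : ∀ a b → ¬ (position a ≡ suc j × position b ≡ e i)
    noEnd 0F b (pa , _) = ≮αend (subst (λ p → α ⟨$⟩ʳ position 1F Fin.< α ⟨$⟩ʳ p) pa descent)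
    noEnd (suc (suc t)) b (pa , _) =
      ≮αend (subst (λ p → α ⟨$⟩ʳ position 0F Fin.< α ⟨$⟩ʳ p) pa (above t))
    noEnd 1F 0F (p1 , pb) = <-asym end<ei (subst₂ Fin._<_ pb p1 (increasing {0F} {1F} z<s))
    noEnd 1F 1F (p1 , pb) = <-irrefl (cong toℕ (trans (sym p1) pb)) end<ei
    noEnd 1F (suc (suc t)) (p1 , pb) = n≮0 (subst (α ⟨$⟩ʳ position 1F Fin.<_)
      (before-e0 (above t) (trans (cong (α ⟨$⟩ʳ_) pb) αei)) descent)

    position-mono : ∀ a b → position a Fin.< position b → c a Fin.< c b
    position-mono a b lt = ↘-mono-< (position↘ a) (position↘ b) lt (noStart a b) (noEnd a b)

    value-mono : ∀ a b → α ⟨$⟩ʳ position a Fin.< α ⟨$⟩ʳ position b → π ⟨$⟩ʳ c a Fin.< π ⟨$⟩ʳ c b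
    -- Applying `α` turns a pair of values into a pair of positions and exchanges the two merged
    -- pairs, hence the swap of `noEnd` and `noStart`.
    value-mono a b lt = ↘-mono-< (↘-addCycle (position↘ a)) (↘-addCycle (position↘ b)) lt
      (λ (αa , αb) → noEnd a b
        ( trans (sym (α-self _)) (cong (α ⟨$⟩ʳ_) αa)
        , trans (sym (α-self _)) (trans (cong (α ⟨$⟩ʳ_) αb) αe0)))
      (λ (αa , αb) → noStart a b
        ( trans (sym (α-self _)) (trans (cong (α ⟨$⟩ʳ_) αa) (addCycle-end j π))
        , trans (sym (α-self _)) (trans (cong (α ⟨$⟩ʳ_) αb) αei)))

-- At most `m` positions, and at most `m` values, exceed `suc j`. An occurrence through position `0`
-- uses it as the 2 and needs `suc m` larger values. One through `suc j` uses it as the 1 and needs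
-- `suc m` later positions. Neither fits, so the occurrence already lies in `π`.
addCycle-has213⋯⁻ : (j : Fin (suc n)) (π : Permutation′ n) →
  n ≤ m + toℕ j → Has213⋯ m (addCycle j π) → Has213⋯ m π
addCycle-has213⋯⁻ {n} {m} j π n≤m+j o = record
  { position   = c
  ; increasing = λ a<b → e-cancel-< (subst₂ Fin._<_ (position≡ _) (position≡ _) (increasing a<b))
  ; descent    = value-mono 1F 0F descent
  ; above      = λ t → value-mono 0F (suc (suc t)) (above t)
  ; rising     = λ {s} {t} s<t → value-mono (suc (suc s)) (suc (suc t)) (rising s<t)
  }
  where
  open AddCycle j π
  open Has213⋯ o

  suc-inc : ∀ {s t : Fin (suc m)} → s Fin.< t → suc (suc s) Fin.< suc (suc t)
  suc-inc s<t = s<s (s<s s<t)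

  tooLong : (f : Fin (suc m) → Fin (2 + n)) → Increasing f → suc j Fin.< f 0F → ⊥
  tooLong f inc lt = <⇒≱ (growth-bound f inc lt) (begin
    2 + n                ≤⟨ s≤s (s≤s n≤m+j) ⟩
    2 + (m + toℕ j)      ≡⟨ cong (2 +_) (+-comm m (toℕ j)) ⟩
    2 + (toℕ j + m)      ≡⟨ cong suc (+-suc (toℕ j) m) ⟨
    suc (toℕ j) + suc m  ∎)
    where open ≤-Reasoning

  position≢start : ∀ a → position a ≢ 0F
  position≢start (suc a) pa = n≮0 (subst (position 0F Fin.<_) pa (increasing {0F} {suc a} z<s))
  position≢start 0F p0 = tooLong (λ t → α ⟨$⟩ʳ position (suc (suc t))) rising
    (subst (λ p → α ⟨$⟩ʳ p Fin.< α ⟨$⟩ʳ position 2F) p0 (above 0F))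

  position≢end : ∀ a → position a ≢ suc j
  position≢end 0F p0 = ≮αend (subst (λ p → α ⟨$⟩ʳ position 1F Fin.< α ⟨$⟩ʳ p) p0 descent)
  position≢end 1F p1 = tooLong (λ t → position (suc (suc t))) (increasing ∘ suc-inc)
    (subst (Fin._< position 2F) p1 (increasing {1F} {2F} (s<s z<s)))
  position≢end (suc (suc t)) pa =
    ≮αend (subst (λ p → α ⟨$⟩ʳ position 0F Fin.< α ⟨$⟩ʳ p) pa (above t))

  preimage : ∀ a → ∃ λ b → position a ≡ e b
  preimage a = go (view j (position a)) refl
    where
    go : ∀ {p} → View j p → position a ≡ p → ∃ λ b → position a ≡ e b
    go start    pa = contradiction pa (position≢start a)
    go end      pa = contradiction pa (position≢end a)
    go (rest b) pa = b , pa

  c : Fin (3 + m) → Fin n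
  c = proj₁ ∘ preimage

  position≡ : ∀ a → position a ≡ e (c a)
  position≡ = proj₂ ∘ preimage

  value-mono : ∀ a b → α ⟨$⟩ʳ position a Fin.< α ⟨$⟩ʳ position b → π ⟨$⟩ʳ c a Fin.< π ⟨$⟩ʳ c b
  value-mono a b lt = αe-< (subst₂ (λ p q → α ⟨$⟩ʳ p Fin.< α ⟨$⟩ʳ q) (position≡ a) (position≡ b) lt)

-- To the right of the value 0, avoiding 132 forces the entries to increase, and there are more than
-- `m` of them. They complete an occurrence as soon as the value 1 stands to the left of the value
-- 0. Given `first π ≤ toℕ j`, this fails only in the excluded case.
addCycle-has213⋯⁺ : (j : Fin (suc n)) (π : Permutation′ n) → SelfInverse π → ¬ Has132 (addCycle j π) →
  first π ≤ toℕ j → m + toℕ j < n → ¬ (toℕ j ≡ first π × 0 < toℕ j) → Has213⋯ m (addCycle j π)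
addCycle-has213⋯⁺ {suc n} {m} j π self avoids first≤j m+j<n j≢first = record
  { position   = p
  ; increasing = λ {a} {b} → p-inc a b
  ; descent    = subst₂ _<_ (sym (cong toℕ (trans (cong (α ⟨$⟩ʳ_) p1≡end) (addCycle-end j π))))
                   (sym (cong toℕ (α-self 1F))) z<s
  ; above      = λ t → subst (_< toℕ (α ⟨$⟩ʳ p (suc (suc t)))) (sym (cong toℕ (α-self 1F)))
                   (≤∧≢⇒< (n≢0⇒n>0 (α≢0 t)) (α≢1 t ∘ sym))
  ; rising     = λ {s} {t} s<t → rises (p-inc 1F (suc (suc s)) (s<s z<s))
                   (p-inc (suc (suc s)) (suc (suc t)) (s<s (s<s s<t)))
  }
  where
  open AddCycle j π
  α-self : SelfInverse α
  α-self = addCycle-selfInverse j π self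

  α1≤j : toℕ (α ⟨$⟩ʳ 1F) ≤ toℕ j
  α1≤j = go (view j 1F) refl
    where
    go : ∀ {q} → View j q → q ≡ 1F → toℕ (α ⟨$⟩ʳ q) ≤ toℕ j
    go end      _  = subst (λ q → toℕ q ≤ toℕ j) (sym (addCycle-end j π)) z≤n
    go (rest a) eq = subst (λ q → toℕ q ≤ toℕ j) (sym (addCycle-rest j π a))
      (subst (_< toℕ j) (sym (punchIn-< j _ πa<j)) πa<j)
      where
      a<j : toℕ a < toℕ j
      a<j = ≰⇒> λ j≤a → 1+n≢0 (suc-injective (trans (cong suc (sym (punchIn-≥ j a j≤a))) (cong toℕ eq)))
      a≡0 : a ≡ 0F
      a≡0 = Finₚ.toℕ-injective (trans (sym (punchIn-< j a a<j)) (suc-injective (cong toℕ eq)))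
      πa<j : toℕ (π ⟨$⟩ʳ a) < toℕ j
      πa<j = ≤∧≢⇒< (subst (λ a → toℕ (π ⟨$⟩ʳ a) ≤ toℕ j) (sym a≡0) first≤j)
        λ eq′ → j≢first (trans (sym eq′) (cong (toℕ ∘ (π ⟨$⟩ʳ_)) a≡0) , ≤-<-trans z≤n a<j)

  bound : ∀ (t : Fin (2 + m)) → suc (toℕ j + toℕ t) < 3 + n
  bound t = s<s (begin-strict
    toℕ j + toℕ t   ≤⟨ +-monoʳ-≤ (toℕ j) (Finₚ.toℕ≤pred[n] t) ⟩
    toℕ j + suc m   ≡⟨ +-suc (toℕ j) m ⟩
    suc (toℕ j + m) ≡⟨ cong suc (+-comm (toℕ j) m) ⟩
    suc (m + toℕ j) <⟨ s<s m+j<n ⟩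
    2 + n           ∎)
    where open ≤-Reasoning

  -- The position of the value 1, then `suc j` with value 0, then the next `suc m` positions.
  p : Fin (3 + m) → Fin (3 + n)
  p 0F      = α ⟨$⟩ʳ 1F
  p (suc t) = fromℕ< (bound t)

  toℕ-p : ∀ t → toℕ (p (suc t)) ≡ suc (toℕ j + toℕ t)
  toℕ-p t = Finₚ.toℕ-fromℕ< (bound t)

  p-inc : ∀ a b → a Fin.< b → p a Fin.< p b
  p-inc 0F      (suc t) _   = subst (toℕ (α ⟨$⟩ʳ 1F) <_) (sym (toℕ-p t))
    (s≤s (≤-trans α1≤j (m≤m+n (toℕ j) (toℕ t))))
  p-inc (suc s) (suc t) s<t = subst₂ _<_ (sym (toℕ-p s)) (sym (toℕ-p t))
    (s<s (+-monoʳ-< (toℕ j) (s<s⁻¹ s<t)))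

  p1≡end : p 1F ≡ suc j
  p1≡end = Finₚ.toℕ-injective (trans (toℕ-p 0F) (cong suc (+-identityʳ (toℕ j))))

  end<p : ∀ t → suc j Fin.< p (suc (suc t))
  end<p t = subst (Fin._< p (suc (suc t))) p1≡end (p-inc 1F (suc (suc t)) (s<s z<s))

  α≢0 : ∀ t → toℕ (α ⟨$⟩ʳ p (suc (suc t))) ≢ 0
  α≢0 t eq = <-irrefl (cong toℕ (trans (cong (α ⟨$⟩ʳ_) (sym (Finₚ.toℕ-injective {j = 0F} eq))) (α-self _))) (end<p t)

  α≢1 : ∀ t → toℕ (α ⟨$⟩ʳ p (suc (suc t))) ≢ 1
  α≢1 t eq = <-irrefl (cong toℕ (trans (cong (α ⟨$⟩ʳ_) (sym (Finₚ.toℕ-injective {j = 1F} eq))) (α-self _)))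
    (p-inc 0F (suc (suc t)) z<s)

  -- A descent to the right of `suc j` would form a 132 with the value 0 there.
  rises : ∀ {a b} → p 1F Fin.< a → a Fin.< b → α ⟨$⟩ʳ a Fin.< α ⟨$⟩ʳ b
  rises {a} {b} 1<a a<b = ≰⇒> λ αb≤αa → avoids (suc j , a , b , subst (Fin._< a) p1≡end 1<a , a<b ,
    subst (λ q → toℕ q < toℕ (α ⟨$⟩ʳ b)) (sym (addCycle-end j π)) (n≢0⇒n>0 λ αb≡0 →
      <-irrefl (cong toℕ (trans p1≡end (trans (cong (α ⟨$⟩ʳ_) (sym (Finₚ.toℕ-injective {j = 0F} αb≡0))) (α-self b))))
        (<-trans 1<a a<b)) ,
    ≤∧≢⇒< αb≤αa λ eq → <-irrefl (cong toℕ (⟨$⟩ʳ-injective α (Finₚ.toℕ-injective (sym eq)))) a<b)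

-- Counting through duplicate-free lists

permutationSetoid : ℕ → Setoid 0ℓ 0ℓ
permutationSetoid n = record
  { Carrier       = Permutation′ n
  ; _≈_           = _≈ₚ_
  ; isEquivalence = record
    { refl  = λ _ → refl
    ; sym   = λ eq i → sym (eq i)
    ; trans = λ eq₁ eq₂ i → trans (eq₁ i) (eq₂ i)
    }
  }

Distinct : List (Permutation′ n) → Set
Distinct = AllPairs (λ π ρ → ¬ (π ≈ₚ ρ))

_∈_ : Permutation′ n → List (Permutation′ n) → Set
α ∈ αs = Any (α ≈ₚ_) αs

lookup-distinct : ∀ {αs : List (Permutation′ n)} → Distinct αs → ∀ i j →
  List.lookup αs i ≈ₚ List.lookup αs j → i ≡ j
lookup-distinct (α# ∷ αs#) zero    zero    eq = refl
lookup-distinct (α# ∷ αs#) zero    (suc j) eq = contradiction eq (All.lookup α# (∈ₚ.∈-lookup j))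
lookup-distinct (α# ∷ αs#) (suc i) zero    eq =
  contradiction (λ p → sym (eq p)) (All.lookup α# (∈ₚ.∈-lookup i))
lookup-distinct (α# ∷ αs#) (suc i) (suc j) eq = cong suc (lookup-distinct αs# i j eq)

-- Sending each index of `αs` to an index of the same permutation in `βs` is injective, because two
-- entries of `αs` found at one place of `βs` are pointwise equal.
distinct-⊆⇒length-≤ : ∀ {αs βs : List (Permutation′ n)} → Distinct αs →
  (∀ {α} → α ∈ αs → α ∈ βs) → length αs ≤ length βs
distinct-⊆⇒length-≤ {n} {αs} {βs} αs# αs⊆βs = Finₚ.injective⇒≤ {f = f} λ {i} {j} eq →
  lookup-distinct αs# i j (Membershipₚ.index-injective S {List.lookup αs i} {List.lookup αs j} (g i) (g j) eq)
  where
  S = permutationSetoid n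
  g : ∀ i → List.lookup αs i ∈ βs
  g i = αs⊆βs {List.lookup αs i} (Membershipₚ.∈-lookup S αs i)
  f : Fin (length αs) → Fin (length βs)
  f i = Any.index (g i)

Avoiding : (k : ℕ) → Permutation′ n → Set
Avoiding k α = SelfInverse α × ¬ Occurrence α pattern132 × ¬ Occurrence α (pattern213⋯ k)

avoiding-cong : {α β : Permutation′ n} → α ≈ₚ β → Avoiding k α → Avoiding k β
avoiding-cong {n} {k} {α} {β} α≈β (self , ¬132 , ¬213⋯) =
  (λ i → trans (sym (trans (cong (α ⟨$⟩ʳ_) (α≈β i)) (α≈β _))) (self i)) ,
  ¬132 ∘ occurrence-cong β≈α , ¬213⋯ ∘ occurrence-cong β≈α
  where
  β≈α : β ≈ₚ α
  β≈α i = sym (α≈β i)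

avoidingInvolution⇒avoiding : (α : Permutation′ n) → AvoidingInvolution k α → Avoiding k α
avoidingInvolution⇒avoiding α (inv , ¬132 , ¬213⋯) =
  involution⇒selfInverse α inv , ¬132 ∘ occurrence⇒contains , ¬213⋯ ∘ occurrence⇒contains

avoiding⇒avoidingInvolution : (α : Permutation′ n) → Avoiding k α → AvoidingInvolution k α
avoiding⇒avoidingInvolution α (self , ¬132 , ¬213⋯) =
  selfInverse⇒involution α self , ¬132 ∘ contains⇒occurrence , ¬213⋯ ∘ contains⇒occurrence

I-length : ∀ k (αs : List (Permutation′ n)) → All (Avoiding k) αs → (∀ {α} → Avoiding k α → α ∈ αs) →
  Distinct αs → I k n ≡ length αs
I-length {n} k αs sound complete distinct = ≤-antisym
  (distinct-⊆⇒length-≤ (AllPairsₚ.filter⁺ P? (permutations-distinct n)) λ {α} α∈ →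
    complete {α} (avoidingInvolution⇒avoiding {k = k} α (proj₂
      (Membershipₚ.∈-filter⁻ S P? (λ {α} {β} → respects α β) {α} {permutations n} α∈))))
  (distinct-⊆⇒length-≤ distinct λ {α} α∈ →
    Membershipₚ.∈-filter⁺ S P? (λ {α} {β} → respects α β) {α} (permutations-complete α)
    (avoiding⇒avoidingInvolution α (lookupAvoiding {α} α∈)))
  where
  S = permutationSetoid n
  P? = avoidingInvolution? k
  lookupAvoiding : ∀ {α} → α ∈ αs → Avoiding k α
  lookupAvoiding {α} α∈ with avoiding , α≈ ← All.lookupAny sound α∈ =
    avoiding-cong {α = List.lookup αs (Any.index α∈)} {α} (λ i → sym (α≈ i)) avoiding
  respects : (α β : Permutation′ n) → α ≈ₚ β → AvoidingInvolution k α → AvoidingInvolution k β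
  respects α β α≈β = avoiding⇒avoidingInvolution β
    ∘ avoiding-cong {α = α} {β} α≈β ∘ avoidingInvolution⇒avoiding α

identity-occurrence : {τ : Permutation′ k} → Occurrence {n} id τ → ∀ {a b} → a Fin.< b → τ ⟨$⟩ʳ a Fin.< τ ⟨$⟩ʳ b
identity-occurrence {τ = τ} o {a} {b} a<b with Finₚ.<-cmp (τ ⟨$⟩ʳ a) (τ ⟨$⟩ʳ b)
... | tri< τa<τb _ _ = τa<τb
... | tri> _ _ τb<τa = contradiction (monotone τb<τa) (<-asym (increasing a<b))
  where open Occurrence o
... | tri≈ _ τa≡τb _ = contradiction a<b (<-irrefl (cong toℕ (⟨$⟩ʳ-injective τ τa≡τb)))

identity-avoiding : Avoiding {n} (2 + m) id
identity-avoiding = (λ _ → refl) ,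
  (λ o → <-asym {1} {2} (s<s z<s) (identity-occurrence o {1F} {2F} (s<s z<s))) ,
  (λ o → n≮0 (identity-occurrence o {0F} {1F} z<s))

-- After a first entry 0, a descent would complete a 132, so `α` is increasing and `i ≤ α i` for all
-- `i`. Applied at `α i`, self-inverseness gives the reverse inequality.
first-0⇒identity : (α : Permutation′ n) → SelfInverse α → ¬ Has132 α → first α ≡ 0 → α ≈ₚ id
first-0⇒identity {suc n} α self ¬132 first≡0 i = Finₚ.toℕ-injective
  (≤-antisym (subst (toℕ (α ⟨$⟩ʳ i) ≤_) (cong toℕ (self i)) (≤α (α ⟨$⟩ʳ i))) (≤α i))
  where
  α0≡0 : α ⟨$⟩ʳ 0F ≡ 0F
  α0≡0 = Finₚ.toℕ-injective first≡0
  0<α : ∀ {b} → 0 < toℕ b → toℕ (α ⟨$⟩ʳ 0F) < toℕ (α ⟨$⟩ʳ b)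
  0<α {b} 0<b = subst (_< toℕ (α ⟨$⟩ʳ b)) (sym first≡0) (n≢0⇒n>0 λ αb≡0 →
    m<n⇒n≢0 0<b (cong toℕ (⟨$⟩ʳ-injective α (trans (Finₚ.toℕ-injective {j = 0F} αb≡0) (sym α0≡0)))))
  increasing : ∀ {a b} → a Fin.< b → α ⟨$⟩ʳ a Fin.< α ⟨$⟩ʳ b
  increasing {zero}  a<b = 0<α a<b
  increasing {suc a} {b} a<b with Finₚ.<-cmp (α ⟨$⟩ʳ suc a) (α ⟨$⟩ʳ b)
  ... | tri< lt _ _ = lt
  ... | tri≈ _ eq _ = contradiction a<b (<-irrefl (cong toℕ (⟨$⟩ʳ-injective α eq)))
  ... | tri> _ _ gt = contradiction (0F , suc a , b , z<s , a<b , 0<α (≤-<-trans z≤n a<b) , gt) ¬132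
  ≤α : ∀ i → toℕ i ≤ toℕ (α ⟨$⟩ʳ i)
  ≤α i = subst (λ m → m + toℕ i ≤ toℕ (α ⟨$⟩ʳ i)) first≡0 (growth (toℕ ∘ (α ⟨$⟩ʳ_)) increasing i)

Admissible : ℕ → ℕ → Permutation′ n → Set
Admissible {n} m i π = first π ≤ i × (n ≤ m + i ⊎ (i ≡ first π × 0 < i))

addCycle-avoiding⁺ : (j : Fin (suc n)) (π : Permutation′ n) → Avoiding (3 + m) π → Admissible m (toℕ j) π →
  Avoiding (3 + m) (addCycle j π)
addCycle-avoiding⁺ {m = m} j π (self , ¬132 , ¬213⋯) (first≤j , adm) =
  addCycle-selfInverse j π self ,
  ¬132 ∘ has132⇒occurrence ∘ addCycle-has132⁻ j π self first≤j ∘ occurrence⇒has132 ,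
  ¬213⋯ ∘ has213⋯⇒occurrence ∘ pullBack j π adm self ∘ occurrence⇒has213⋯
  where
  pullBack : ∀ {n} (j : Fin (suc n)) (π : Permutation′ n) → n ≤ m + toℕ j ⊎ (toℕ j ≡ first π × 0 < toℕ j) →
    SelfInverse π → Has213⋯ m (addCycle j π) → Has213⋯ m π
  pullBack         j    π (inj₁ n≤m+j)           self = addCycle-has213⋯⁻ j π n≤m+j
  -- Merging needs a nonempty `π`; at size 0 the only `j` is 0, against `0 < j`.
  pullBack {zero}  zero π (inj₂ (_ , ()))        self
  pullBack {suc n} j    π (inj₂ (j≡first , 0<j)) self = merge-has213⋯ j π self j≡first 0<j

addCycle-avoiding⁻ : (j : Fin (suc n)) (π : Permutation′ n) → Avoiding (3 + m) (addCycle j π) →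
  Avoiding (3 + m) π × Admissible m (toℕ j) π
addCycle-avoiding⁻ {n} {m} j π (self , ¬132 , ¬213⋯) =
  (self′ , ¬132 ∘ addCycle-occurrence j π , ¬213⋯ ∘ addCycle-occurrence j π) , first≤j , adm
  where
  self′ : SelfInverse π
  self′ = addCycle-selfInverse⁻¹ j π self
  first≤j : first π ≤ toℕ j
  first≤j = ≮⇒≥ (¬132 ∘ has132⇒occurrence ∘ addCycle-has132⁺ j π self′)
  adm : n ≤ m + toℕ j ⊎ (toℕ j ≡ first π × 0 < toℕ j)
  adm with n ≤? m + toℕ j | toℕ j ≟ first π ×-dec 0 <? toℕ j
  ... | yes n≤m+j | _           = inj₁ n≤m+j
  ... | no  _     | yes j≡first = inj₂ j≡first
  ... | no  n≰m+j | no  j≢first = contradiction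
    (has213⋯⇒occurrence (addCycle-has213⋯⁺ j π self′ (¬132 ∘ has132⇒occurrence) first≤j (≰⇒> n≰m+j) j≢first)) ¬213⋯

-- Enumeration by the first entry

module Enumeration (m : ℕ) where

  -- Avoiding involutions of size `n`: with first entry exactly `i`, with first entry below `t`, and
  -- admissible for the 2-cycle `(0 suc i)`. The decision is an argument of `parents` so that later
  -- proofs can split on it. Its negative case leaves only the first entry `i` with `i` positive,
  -- hence `positive`.
  family   : ∀ n → ℕ → List (Permutation′ n)
  below    : ∀ n → ℕ → List (Permutation′ n)
  parents  : ∀ n i → Dec (n ≤ m + i) → List (Permutation′ n)
  positive : ∀ n → ℕ → List (Permutation′ n)

  family n        zero    = [ id ]
  family 0        (suc i) = []
  family 1        (suc i) = []
  family (2+ n)   (suc i) with i <? suc n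
  ... | yes i<1+n = map (addCycle (fromℕ< i<1+n)) (parents n i (n ≤? m + i))
  ... | no  _     = []

  below n zero    = []
  below n (suc t) = family n t ++ below n t

  parents n i (yes _) = below n (suc i)
  parents n i (no _)  = positive n i

  positive n zero    = []
  positive n (suc i) = family n (suc i)

  family-sound : ∀ n i → All (λ α → Avoiding (3 + m) α × first α ≡ i) (family n i)
  below-sound : ∀ n t → All (λ α → Avoiding (3 + m) α × first α < t) (below n t)
  parents-sound : ∀ n i d → All (λ α → Avoiding (3 + m) α × Admissible m i α) (parents n i d)

  family-sound zero    zero    = (identity-avoiding , refl) ∷ []
  family-sound (suc n) zero    = (identity-avoiding , refl) ∷ []
  family-sound 0       (suc i) = []
  family-sound 1       (suc i) = []
  family-sound (2+ n)  (suc i) with i <? suc n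
  ... | no  _     = []
  ... | yes i<1+n = Allₚ.map⁺ (All.map
    (λ {π} (av , adm) → addCycle-avoiding⁺ _ π av (subst (λ i → Admissible m i π) (sym toℕ-i) adm) , cong suc toℕ-i)
    (parents-sound n i (n ≤? m + i)))
    where
    toℕ-i : toℕ (fromℕ< i<1+n) ≡ i
    toℕ-i = Finₚ.toℕ-fromℕ< i<1+n

  below-sound n zero    = []
  below-sound n (suc t) = Allₚ.++⁺
    (All.map (λ (av , eq) → av , ≤-reflexive (cong suc eq)) (family-sound n t))
    (All.map (λ (av , lt) → av , m<n⇒m<1+n lt) (below-sound n t))

  parents-sound n i       (yes n≤m+i) = All.map (λ (av , lt) → av , s≤s⁻¹ lt , inj₁ n≤m+i) (below-sound n (suc i))
  parents-sound n zero    (no _)      = []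
  parents-sound n (suc i) (no _)      =
    All.map (λ (av , eq) → av , ≤-reflexive eq , inj₂ (sym eq , z<s)) (family-sound n (suc i))

  family-complete : ∀ n i {α} → Avoiding (3 + m) α → first α ≡ i → α ∈ family n i
  below-complete : ∀ n t {α} → Avoiding (3 + m) α → first α < t → α ∈ below n t
  parents-complete : ∀ n i d {α} → Avoiding (3 + m) α → Admissible m i α → α ∈ parents n i d

  family-complete n       zero    {α} (self , ¬132 , _) eq =
    here (first-0⇒identity α self (¬132 ∘ has132⇒occurrence) eq)
  family-complete 1       (suc i) {α} _ eq with α ⟨$⟩ʳ 0F
  family-complete 1       (suc i) {α} _ () | zero
  family-complete (2+ n)  (suc i) {α} av@(self , _) eq with i <? suc n
  ... | no  i≮1+n = contradiction (s<s⁻¹ (subst (_< 2 + n) eq (Finₚ.toℕ<n (α ⟨$⟩ʳ 0F)))) i≮1+n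
  ... | yes i<1+n =
    Anyₚ.map⁺ (Any.map (λ {ρ} π≈ρ p → trans (α≈ p) (addCycle-cong (fromℕ< i<1+n) {π} {ρ} π≈ρ p))
      (parents-complete n i (n ≤? m + i) (proj₁ split)
        (subst (λ i → Admissible m i π) toℕ-i (proj₂ split))))
    where
    toℕ-i : toℕ (fromℕ< i<1+n) ≡ i
    toℕ-i = Finₚ.toℕ-fromℕ< i<1+n
    α0≡ : α ⟨$⟩ʳ 0F ≡ suc (fromℕ< i<1+n)
    α0≡ = Finₚ.toℕ-injective (trans eq (cong suc (sym toℕ-i)))
    π : Permutation′ n
    π = proj₁ (addCycle-complete α self α0≡)
    α≈ : α ≈ₚ addCycle (fromℕ< i<1+n) π
    α≈ = proj₂ (addCycle-complete α self α0≡)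
    split : Avoiding (3 + m) π × Admissible m (toℕ (fromℕ< i<1+n)) π
    split = addCycle-avoiding⁻ _ π (avoiding-cong {α = α} {addCycle (fromℕ< i<1+n) π} α≈ av)

  below-complete n (suc t) {α} av lt with first α ≟ t
  ... | yes eq = Anyₚ.++⁺ˡ (family-complete n t av eq)
  ... | no  ≢t = Anyₚ.++⁺ʳ (family n t) (below-complete n t av (≤∧≢⇒< (s≤s⁻¹ lt) ≢t))

  parents-complete n i       (yes _)     av (first≤i , _)            = below-complete n (suc i) av (s≤s first≤i)
  parents-complete n i       (no n≰m+i)  av (_ , inj₁ n≤m+i)         = contradiction n≤m+i n≰m+i
  parents-complete n (suc i) (no _)      av (_ , inj₂ (i≡first , _)) = family-complete n (suc i) av (sym i≡first)

  family-distinct : ∀ n i → Distinct (family n i)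
  below-distinct : ∀ n t → Distinct (below n t)
  parents-distinct : ∀ n i d → Distinct (parents n i d)

  family-distinct n       zero    = [] ∷ []
  family-distinct 0       (suc i) = []
  family-distinct 1       (suc i) = []
  family-distinct (2+ n)  (suc i) with i <? suc n
  ... | no  _     = []
  ... | yes i<1+n = AllPairsₚ.map⁺ (AllPairs.map
    (λ {π} {ρ} π≉ρ eq → π≉ρ (addCycle-injective (fromℕ< i<1+n) {π} {ρ} eq)) (parents-distinct n i (n ≤? m + i)))

  below-distinct n zero    = []
  below-distinct n (suc t) = AllPairsₚ.++⁺ (family-distinct n t) (below-distinct n t)
    (All.map (λ {α} (_ , α≡t) → All.map (λ {β} (_ , β<t) α≈β →
        <-irrefl (trans (sym (first-cong {α = α} {β} α≈β)) α≡t) β<t) (below-sound n t))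
      (family-sound n t))

  parents-distinct n i       (yes _) = below-distinct n (suc i)
  parents-distinct n zero    (no _)  = []
  parents-distinct n (suc i) (no _)  = family-distinct n (suc i)

  I-below : ∀ n → I (3 + m) n ≡ length (below n (suc n))
  I-below n = I-length (3 + m) (below n (suc n)) (All.map proj₁ (below-sound n (suc n)))
    (λ {α} av → below-complete n (suc n) av (first-< α)) (below-distinct n (suc n))

-- From first entries to walks

module Counting (m : ℕ) where
  open Enumeration m
  open ≡-Reasoning

  c S : ℕ → ℕ → ℕ
  c n i = length (family n i)
  S n t = length (below n t)

  S-suc : ∀ n t → S n (suc t) ≡ c n t + S n t
  S-suc n t = length-++ (family n t)

  c-0 : ∀ n → c n 0 ≡ 1
  c-0 zero    = refl
  c-0 (suc n) = refl

  S-1 : ∀ n → S n 1 ≡ 1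
  S-1 n = trans (S-suc n 0) (cong (_+ 0) (c-0 n))

  c-parents : ∀ n i → i ≤ n → c (2 + n) (suc i) ≡ length (parents n i (n ≤? m + i))
  c-parents n i i≤n with i <? suc n
  ... | yes _     = length-map _ (parents n i (n ≤? m + i))
  ... | no  i≮1+n = contradiction (s≤s i≤n) i≮1+n

  c-beyond : ∀ n → c (suc n) (suc n) ≡ 0
  c-beyond zero    = refl
  c-beyond (suc n) with suc n <? suc n
  ... | yes n<n = contradiction n<n (n≮n _)
  ... | no  _   = refl

  c-near : ∀ n i → i ≤ n → n ≤ m + i → c (2 + n) (suc i) ≡ S n (suc i)
  c-near n i i≤n n≤m+i rewrite c-parents n i i≤n with n ≤? m + i
  ... | yes _     = refl
  ... | no  n≰m+i = contradiction n≤m+i n≰m+i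

  c-far : ∀ n i → m + i < n → c (2 + n) (suc i) ≡ length (positive n i)
  c-far n i m+i<n rewrite c-parents n i (≤-trans (m≤n+m i m) (<⇒≤ m+i<n)) with n ≤? m + i
  ... | yes n≤m+i = contradiction n≤m+i (<⇒≱ m+i<n)
  ... | no  _     = refl

  -- In this range a first entry `suc i` with `i` positive comes from a first entry `i` at size `n`,
  -- first entry 1 does not occur, and the identities of both sizes correspond.
  S-far : ∀ n t → m + t < n → S (2 + n) (2 + t) ≡ S n (suc t)
  S-far n zero    lt = begin
    S (2 + n) 2                   ≡⟨ S-suc (2 + n) 1 ⟩
    c (2 + n) 1 + S (2 + n) 1     ≡⟨ cong₂ _+_ (c-far n 0 lt) (S-1 (2 + n)) ⟩
    1                             ≡⟨ S-1 n ⟨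
    S n 1                         ∎
  S-far n (suc t) lt = begin
    S (2 + n) (3 + t)                         ≡⟨ S-suc (2 + n) (2 + t) ⟩
    c (2 + n) (2 + t) + S (2 + n) (2 + t)
      ≡⟨ cong₂ _+_ (c-far n (suc t) lt) (S-far n t (<-trans (+-monoʳ-< m ≤-refl) lt)) ⟩
    c n (suc t) + S n (suc t)                 ≡⟨ S-suc n (suc t) ⟨
    S n (2 + t)                               ∎

  -- Involutions of size h + 1 + p whose first entry is at most p are counted by walks from h + 2.
  Matches : ℕ → ℕ → Set
  Matches p h = S (suc (h + p)) (suc p) ≡ departures (3 + m) p (2 + h)

  matches-zero : ∀ h → h ≤ suc m → Matches 0 h
  matches-zero h h≤1+m = trans (S-1 (suc (h + 0))) (sym (if-true (<⇒<ᵇ (s<s (s<s h≤1+m)))))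

  -- A first entry `suc p` does not exist at size `suc p`, so from vertex 1 there is only the step
  -- to vertex 2.
  total-suc : ∀ p → Matches p 0 → S (suc p) (2 + p) ≡ departures (3 + m) (suc p) 1
  total-suc p matches = begin
    S (suc p) (2 + p)                      ≡⟨ S-suc (suc p) (suc p) ⟩
    c (suc p) (suc p) + S (suc p) (suc p)  ≡⟨ cong₂ _+_ (c-beyond p) matches ⟩
    departures (3 + m) p 2                       ≡⟨ cong (_+ departures (3 + m) p 2) (departures-0 (3 + m) p) ⟨
    departures (3 + m) p 0 + departures (3 + m) p 2    ∎

  -- The situation at vertex `k`. All first entries from 1 to `suc p` are in the far range, so both
  -- summands shrink to size `suc (m + p)` and recombine into a single count, that of the neighbour
  -- `2 + m`.
  edge : ∀ p → Matches p m →
    c (3 + (m + p)) (suc p) + S (3 + (m + p)) (suc p) ≡ departures (3 + m) p (2 + m)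
  edge zero    eq = begin
    c (3 + (m + 0)) 1 + S (3 + (m + 0)) 1 ≡⟨ cong₂ _+_ (c-far (suc (m + 0)) 0 ≤-refl) (S-1 (3 + (m + 0))) ⟩
    1                                     ≡⟨ S-1 (suc (m + 0)) ⟨
    S (suc (m + 0)) 1                     ≡⟨ eq ⟩
    departures (3 + m) 0 (2 + m)                ∎
  edge (suc p) eq = begin
    c (3 + (m + suc p)) (2 + p) + S (3 + (m + suc p)) (2 + p)
      ≡⟨ cong₂ _+_ (c-far (suc (m + suc p)) (suc p) ≤-refl)
           (S-far (suc (m + suc p)) p (s<s (+-monoʳ-≤ m (n≤1+n p)))) ⟩
    c (suc (m + suc p)) (suc p) + S (suc (m + suc p)) (suc p)
      ≡⟨ S-suc (suc (m + suc p)) (suc p) ⟨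
    S (suc (m + suc p)) (2 + p) ≡⟨ eq ⟩
    departures (3 + m) (suc p) (2 + m) ∎

  -- The first summand has its first entry at the bound `suc p`. For `h ≤ m` every smaller avoiding
  -- involution with first entry at most `p` is a parent, which gives vertex `1 + h`; the second
  -- summand gives vertex `3 + h`. The hypothesis `previous` is separate because at `h = 0` it is
  -- the full count at vertex 1 and not an instance of `Matches`.
  recurrence : ∀ p h → h ≤ suc m → (h ≤ m → S (h + p) (suc p) ≡ departures (3 + m) p (1 + h)) →
    (∀ h → h ≤ suc m → Matches p h) →
    c (2 + (h + p)) (suc p) + S (2 + (h + p)) (suc p) ≡ departures (3 + m) p (1 + h) + departures (3 + m) p (3 + h)
  recurrence p h h≤1+m previous matches with h ≤? m
  ... | yes h≤m = cong₂ _+_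
    (trans (c-near (h + p) p (m≤n+m p h) (+-monoˡ-≤ p h≤m)) (previous h≤m))
    (matches (suc h) (s≤s h≤m))
  ... | no  h≰m with refl ← ≤-antisym h≤1+m (≰⇒> h≰m) = begin
    c (3 + (m + p)) (suc p) + S (3 + (m + p)) (suc p) ≡⟨ edge p (matches m (n≤1+n m)) ⟩
    departures (3 + m) p (2 + m)                            ≡⟨ +-identityʳ _ ⟨
    departures (3 + m) p (2 + m) + 0
      ≡⟨ cong (departures (3 + m) p (2 + m) +_) (departures-end (3 + m) p) ⟨
    departures (3 + m) p (2 + m) + departures (3 + m) p (4 + m)   ∎

  matches-suc : ∀ p h → h ≤ suc m → (h ≤ m → S (h + p) (suc p) ≡ departures (3 + m) p (1 + h)) →
    (∀ h → h ≤ suc m → Matches p h) → Matches (suc p) h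
  matches-suc p h h≤1+m previous matches = begin
    S (suc (h + suc p)) (2 + p)                   ≡⟨ cong (λ n → S (suc n) (2 + p)) (+-suc h p) ⟩
    S (2 + (h + p)) (2 + p)                       ≡⟨ S-suc (2 + (h + p)) (suc p) ⟩
    c (2 + (h + p)) (suc p) + S (2 + (h + p)) (suc p)
      ≡⟨ recurrence p h h≤1+m previous matches ⟩
    departures (3 + m) p (1 + h) + departures (3 + m) p (3 + h)
      ≡⟨ step-< (departures (3 + m) p) (s≤s (s≤s h≤1+m)) ⟨
    departures (3 + m) (suc p) (2 + h) ∎

  S-departures : ∀ p h → h ≤ suc m → Matches p h
  total-departures : ∀ p → S p (suc p) ≡ departures (3 + m) p 1

  total-departures zero    = refl
  total-departures (suc p) = total-suc p (S-departures p 0 z≤n)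

  S-departures zero    h       h≤1+m = matches-zero h h≤1+m
  S-departures (suc p) zero    h≤1+m = matches-suc p 0 h≤1+m (λ _ → total-departures p) (S-departures p)
  S-departures (suc p) (suc h) h≤1+m =
    matches-suc p (suc h) h≤1+m (λ _ → S-departures p h (≤-trans (n≤1+n h) h≤1+m)) (S-departures p)

  -- The detour through k keeps I from being unfolded when the sizes are compared.
  I-departures-≥3 : ∀ {k} n → k ≡ 3 + m → I k n ≡ departures k n 1
  I-departures-≥3 n refl = trans (I-below n) (total-departures n)

-- The patterns 1 and 21

I-departures-1 : ∀ n → I 1 n ≡ departures 1 n 1
I-departures-1 zero    = I-length {0} 1 [ id ]
  (((λ ()) , (λ o → Fin0 (Occurrence.position o 0F)) , (λ o → Fin0 (Occurrence.position o 0F))) ∷ [])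
  (λ _ → here (λ ())) ([] ∷ [])
  where
  Fin0 : ¬ Fin 0
  Fin0 ()
I-departures-1 (suc n) = begin
  I 1 (suc n)        ≡⟨ I-length {suc n} 1 [] [] (λ {α} (_ , _ , ¬1) → contradiction (occurs α) ¬1) [] ⟩
  0                  ≡⟨ cong₂ _+_ (departures-0 1 n) (departures-end 1 n) ⟨
  departures 1 n 0 + departures 1 n 2 ∎
  where
  open ≡-Reasoning
  occurs : ∀ α → Occurrence {suc n} α (pattern213⋯ 1)
  occurs α = record { position = λ _ → 0F ; increasing = λ { {0F} {0F} () } ; monotone = λ { {0F} {0F} () } }

-- Avoiding 21 leaves only the identity, and a path with two vertices has exactly one walk of each
-- length from either vertex.
I-departures-2 : ∀ n → I 2 n ≡ departures 2 n 1
I-departures-2 n = trans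
  (I-length {n} 2 [ id ] (identity-avoiding ∷ [])
    (λ {α} (self , ¬132 , ¬21) → here (first-0⇒identity α self (¬132 ∘ has132⇒occurrence) (first-0 α self ¬21)))
    ([] ∷ []))
  (sym (proj₁ (walks n)))
  where
  walks : ∀ n → departures 2 n 1 ≡ 1 × departures 2 n 2 ≡ 1
  walks zero    = refl , refl
  walks (suc n) with eq₁ , eq₂ ← walks n =
    cong₂ _+_ (departures-0 2 n) eq₂ , cong₂ _+_ eq₁ (departures-end 2 n)
  first-0 : ∀ {n} (α : Permutation′ n) → SelfInverse α → ¬ Occurrence α (pattern213⋯ 2) → first α ≡ 0
  first-0 {zero}  α self ¬21 = refl
  -- The value 0 stands at position `α ⟨$⟩ʳ 0F`; if that is not position 0, the two positions form a
  -- 21.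
  first-0 {suc n} α self ¬21 = n≤0⇒n≡0 (≮⇒≥ λ 0<α0 → ¬21 (record
    { position   = λ { 0F → 0F ; 1F → α ⟨$⟩ʳ 0F }
    ; increasing = λ { {0F} {1F} _ → 0<α0 ; {0F} {0F} () ; {1F} {1F} (s≤s ()) }
    ; monotone   = λ { {0F} {0F} lt → contradiction lt (n≮n 1)
                     ; {0F} {1F} ()
                     ; {1F} {1F} ()
                     ; {1F} {0F} _ → subst (λ p → toℕ p < toℕ (α ⟨$⟩ʳ 0F)) (sym (self 0F)) 0<α0 }
    }))

I-departures : ∀ k n → 1 ≤ k → I k n ≡ departures k n 1
I-departures 1               n _ = I-departures-1 n
I-departures 2               n _ = I-departures-2 n
I-departures (suc (2+ m))    n _ = Counting.I-departures-≥3 m n refl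

theorem2p9 : (k : ℕ) → 1 ≤ k →
    ∃ λ r → (r * (x * U k ½x⁻¹) ≈ 1#)
    × (generatingFunction (I k) ≈ r * sum (λ (j : Fin k) → U (toℕ j) ½x⁻¹))
theorem2p9 k 1≤k = generatingFunction-departures k 1≤k {I k} (λ n → I-departures k n 1≤k)
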